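{- Let $G$ be a locally profinite group, $Z$ a closed central subgroup of $G$, $C$ a field, and $\mathfrak X$ a set of $C$-types in $G$. Let $\mathfrak X'$ be the set of $C$-types $(J',V')$ where, for $(J,V)\in\mathfrak X$, $J'$ is the $G$-normalizer of $J$ and $V'$ is the isomorphism class of $\operatorname{ind}_J^{J'}V$. Let $\mathcal Z$ be a set of isomorphism classes of irreducible $Z$-compact smooth $C$-representations of $G$, and $H\subset\operatorname{Aut}(C)$ a subgroup. If $\mathfrak X$ satisfies intertwining (resp. unicity, resp. $\mathcal Z$-exhaustion, resp. $H$-stability), then so does $\mathfrak X'$. If $\mathfrak X$ satisfies unicity and $H$-stability, then $\mathfrak X'$ satisfies $H$-unicity.
   Context: $\operatorname{ind}_J^G$ denotes compact induction of smooth representations from an open subgroup $J$. A $C$-type in $G$ is a pair $(J,V)$ with $J\subset G$ an open subgroup and $V$ an isomorphism class of irreducible smooth $C$-representations of $J$ such that $\operatorname{ind}_J^GV$ is irreducible. A smooth $C$-representation $W$ of $G$ is $Z$-compact if for all small enough compact open subgroups $K\subset G$ (of pro-order invertible in $C$, whose existence is assumed when this notion is used) and all $w\in W$ the support of $g\mapsto e_Kgw$ is compact modulo $Z$, where $e_K$ is the projector onto $K$-invariants given by averaging over $K$. $\mathfrak X$ satisfies: intertwining if for each $(J,V)\in\mathfrak X$ the natural injection $\operatorname{End}_{C[J]}(V)\to\operatorname{End}_{C[G]}(\operatorname{ind}_J^GV)$ is an isomorphism; unicity if $\operatorname{ind}_J^GV\simeq\operatorname{ind}_{J_1}^GV_1$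 with $(J,V),(J_1,V_1)\in\mathfrak X$ implies that some $g\in G$ conjugates $(J,V)$ to $(J_1,V_1)$; $\mathcal Z$-exhaustion if for $(J,V)\in\mathfrak X$ the class of $\operatorname{ind}_J^GV$ is in $\mathcal Z$ and any element of $\mathcal Z$ has that form; $H$-stability if $(J,\sigma(V))\in\mathfrak X$ for all $(J,V)\in\mathfrak X$ and $\sigma\in H$, where $\sigma(V)=C\otimes_{\sigma,C}V$; $H$-unicity if it is $H$-stable and for $(J,V)\in\mathfrak X$, $\sigma\in H$, $\operatorname{ind}_J^GV\simeq\operatorname{ind}_J^G\sigma(V)$ implies $V\simeq\sigma(V)$. -}

module Defs where

open import Level using (Level; _⊔_; suc)
open import Algebra.Bundles using (Group; AbelianGroup; CommutativeRing)
open import Algebra.Module.Bundles using (LeftModule)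
open import Algebra.Morphism.Structures using (module RingMorphisms)
import Algebra.Definitions.RawMonoid as Multiples
import Algebra.Morphism.Construct.Composition as Compose
import Algebra.Morphism.Construct.Identity as Identity
import Algebra.Properties.Group as GroupProperties
import Algebra.Properties.AbelianGroup as AbelianGroupProperties
import Algebra.Properties.CommutativeSemigroup as CommutativeSemigroupProperties
open import Data.List.Base using (List; []; _∷_; _++_; map; foldr; length)
open import Data.List.Relation.Unary.All using (All)
open import Data.List.Relation.Unary.AllPairs using (AllPairs)
open import Data.List.Relation.Unary.Any as Any using (Any)
open import Data.List.Relation.Unary.Any.Properties using (++⁺ˡ; ++⁺ʳ)
open import Data.Product.Base using (Σ; ∃; ∃₂; _×_; _,_; proj₁; proj₂)
open import Data.Sum.Base using (_⊎_; inj₁; inj₂)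
open import Data.Unit.Polymorphic.Base using (⊤; tt)
open import Data.Empty.Polymorphic using (⊥)
open import Function.Base using (_∘_)
open import Function.Definitions using (Bijective)
open import Relation.Binary.Core using (Rel)
open import Relation.Binary.Definitions using (_Respects_)
open import Relation.Nullary.Negation.Core using (¬_)
open import Relation.Unary using (Pred; _∈_; _⊆_; _≐_; _∩_; _∪_; ⋃)
import Relation.Binary.Reasoning.Setoid as SetoidReasoning

record Subgroup {ℓ} (G : Group ℓ ℓ) : Set (suc ℓ) where
  open Group G
  field
    Mem  : Pred Carrier ℓ
    resp : Mem Respects _≈_
    ε∈   : ε ∈ Mem
    ∙∈   : ∀ {x y} → x ∈ Mem → y ∈ Mem → x ∙ y ∈ Mem
    ⁻¹∈  : ∀ {x} → x ∈ Mem → x ⁻¹ ∈ Mem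

record Field ℓ : Set (suc ℓ) where
  field
    commutativeRing : CommutativeRing ℓ ℓ
  open CommutativeRing commutativeRing public
  field
    1≉0     : ¬ (1# ≈ 0#)
    inverse : ∀ x → ¬ (x ≈ 0#) → ∃ λ y → x * y ≈ 1#

module _ {ℓ} (C : Field ℓ) where
  open Field C
  open RingMorphisms rawRing rawRing

  record Automorphism : Set ℓ where
    field
      ⟦_⟧               : Carrier → Carrier
      isRingIsomorphism : IsRingIsomorphism ⟦_⟧
    open IsRingIsomorphism isRingIsomorphism public

  private
    inverseAut : Automorphism → Automorphism
    inverseAut σ = record
      { ⟦_⟧ = inv
      ; isRingIsomorphism = record
        { isRingMonomorphism = record
          { isRingHomomorphism = record
            { isSemiringHomomorphism = record
              { isNearSemiringHomomorphism = record
                { +-isMonoidHomomorphism = record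
                  { isMagmaHomomorphism = record
                    { isRelHomomorphism = record
                      { cong = λ x≈y → injective (trans (right _) (trans x≈y (sym (right _)))) }
                    ; homo = λ x y → injective
                        (trans (right _) (sym (trans (+-homo _ _) (+-cong (right x) (right y)))))
                    }
                  ; ε-homo = injective (trans (right _) (sym 0#-homo))
                  }
                ; *-homo = λ x y → injective
                    (trans (right _) (sym (trans (*-homo _ _) (*-cong (right x) (right y)))))
                }
              ; 1#-homo = injective (trans (right _) (sym 1#-homo))
              }
            ; -‿homo = λ x → injective
                (trans (right _) (sym (trans (-‿homo _) (-‿cong (right x)))))
            }
          ; injective = λ {x} {y} p → trans (sym (right x)) (trans (⟦⟧-cong p) (right y))
          }
        ; surjective = λ x → ⟦_⟧ x , λ {z} z≈ → injective (trans (right z) z≈)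
        }
      }
      where
      open Automorphism σ
      inv : Carrier → Carrier
      inv x = proj₁ (surjective x)
      right : ∀ x → ⟦ inv x ⟧ ≈ x
      right x = proj₂ (surjective x) refl

  Aut : Group ℓ ℓ
  Aut = record
    { Carrier = Automorphism
    ; _≈_ = λ σ τ → ∀ x → ⟦ σ ⟧ x ≈ ⟦ τ ⟧ x
    ; _∙_ = λ σ τ → record
        { ⟦_⟧ = ⟦ σ ⟧ ∘ ⟦ τ ⟧
        ; isRingIsomorphism =
            Compose.isRingIsomorphism trans (isRingIsomorphism τ) (isRingIsomorphism σ) }
    ; ε = record
        { ⟦_⟧ = λ x → x
        ; isRingIsomorphism = Identity.isRingIsomorphism rawRing refl }
    ; _⁻¹ = inverseAut
    ; isGroup = record
      { isMonoid = record
        { isSemigroup = record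
          { isMagma = record
            { isEquivalence = record
              { refl = λ _ → refl
              ; sym = λ p x → sym (p x)
              ; trans = λ p q x → trans (p x) (q x) }
            ; ∙-cong = λ {_} {σ} p q x → trans (p _) (⟦⟧-cong σ (q x)) }
          ; assoc = λ _ _ _ _ → refl }
        ; identity = (λ _ _ → refl) , (λ _ _ → refl) }
      ; inverse = (λ σ x → injective σ (right σ (⟦ σ ⟧ x))) , right
      ; ⁻¹-cong = λ {σ} {τ} p x → injective σ
          (trans (right σ x) (sym (trans (p _) (right τ x)))) }
    }
    where
    open Automorphism
    right : ∀ σ x → ⟦ σ ⟧ (⟦ inverseAut σ ⟧ x) ≈ x
    right σ x = proj₂ (surjective σ x) refl

record TopologicalGroup ℓ : Set (suc (suc ℓ)) where
  field
    group : Group ℓ ℓ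
  open Group group public
  field
    IsOpen        : Pred Carrier ℓ → Set (suc ℓ)
    open-resp-≈   : ∀ {U} → IsOpen U → U Respects _≈_
    open-resp-≐   : ∀ {U V} → U ≐ V → IsOpen U → IsOpen V
    ⊤-open        : IsOpen (λ _ → ⊤)
    ∩-open        : ∀ {U V} → IsOpen U → IsOpen V → IsOpen (U ∩ V)
    ⋃-open        : ∀ {I : Set ℓ} (F : I → Pred Carrier ℓ) →
                    (∀ i → IsOpen (F i)) → IsOpen (⋃ I F)
    ∙-continuous  : ∀ {U} → IsOpen U → ∀ {x y} → x ∙ y ∈ U →
                    ∃₂ λ V W → IsOpen V × IsOpen W × x ∈ V × y ∈ W ×
                               (∀ {a b} → a ∈ V → b ∈ W → a ∙ b ∈ U)
    ⁻¹-continuous : ∀ {U} → IsOpen U → IsOpen (λ x → x ⁻¹ ∈ U)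

  IsClosed : Pred Carrier ℓ → Set (suc ℓ)
  IsClosed S = IsOpen (λ x → ¬ (x ∈ S))

  HasFiniteSubcover : ∀ {a} {I : Set ℓ} → (I → Pred Carrier ℓ) → Pred Carrier a → Set (ℓ ⊔ a)
  HasFiniteSubcover F S = ∃ λ is → ∀ {x} → x ∈ S → Any (λ i → x ∈ F i) is

  IsCompact : ∀ {a} → Pred Carrier a → Set (suc ℓ ⊔ a)
  IsCompact S = ∀ {I : Set ℓ} (F : I → Pred Carrier ℓ) → (∀ i → IsOpen (F i)) →
                S ⊆ ⋃ I F → HasFiniteSubcover F S

  -- Compactness of the image of S in J\G, whose open subsets are the open
  -- subsets of G stable under left translation by J.
  IsCompactMod : ∀ {a} → Subgroup group → Pred Carrier a → Set (suc ℓ ⊔ a)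
  IsCompactMod J S = ∀ {I : Set ℓ} (F : I → Pred Carrier ℓ) → (∀ i → IsOpen (F i)) →
                     (∀ i {j x} → j ∈ Subgroup.Mem J → x ∈ F i → j ∙ x ∈ F i) →
                     S ⊆ ⋃ I F → HasFiniteSubcover F S

record LocallyProfiniteGroup ℓ : Set (suc (suc ℓ)) where
  field
    topologicalGroup : TopologicalGroup ℓ
  open TopologicalGroup topologicalGroup public
  field
    hausdorff : ∀ {x y} → ¬ (x ≈ y) →
                ∃₂ λ U V → IsOpen U × IsOpen V × x ∈ U × y ∈ V × (∀ {z} → z ∈ U → ¬ (z ∈ V))
    small-compact-open : ∀ {U} → IsOpen U → ε ∈ U →
                ∃ λ (K : Subgroup group) →
                  IsOpen (Subgroup.Mem K) × IsCompact (Subgroup.Mem K) × Subgroup.Mem K ⊆ U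

module Subgroups {ℓ} (G : LocallyProfiniteGroup ℓ) where
  open LocallyProfiniteGroup G
  open GroupProperties group
  open SetoidReasoning setoid
  open Subgroup

  Sub : Set (suc ℓ)
  Sub = Subgroup group

  record OpenSubgroup : Set (suc ℓ) where
    field
      sub     : Sub
      is-open : IsOpen (Mem sub)
    open Subgroup sub public

  whole : Sub
  whole = record
    { Mem = λ _ → ⊤ ; resp = λ _ _ → tt ; ε∈ = tt ; ∙∈ = λ _ _ → tt ; ⁻¹∈ = λ _ → tt }

  IsCentral : Sub → Set ℓ
  IsCentral Z = ∀ {z} → z ∈ Mem Z → ∀ g → z ∙ g ≈ g ∙ z

  conjugate : Carrier → Carrier → Carrier
  conjugate g x = g ∙ x ∙ g ⁻¹

  conjugate-cong : ∀ {g h x y} → g ≈ h → x ≈ y → conjugate g x ≈ conjugate h y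
  conjugate-cong p q = ∙-cong (∙-cong p q) (⁻¹-cong p)

  conjugate-∙ : ∀ g x y → conjugate g (x ∙ y) ≈ conjugate g x ∙ conjugate g y
  conjugate-∙ g x y = sym (begin
    g ∙ x ∙ g ⁻¹ ∙ (g ∙ y ∙ g ⁻¹)    ≈⟨ assoc _ _ _ ⟩
    g ∙ x ∙ (g ⁻¹ ∙ (g ∙ y ∙ g ⁻¹))  ≈⟨ ∙-congˡ (∙-congˡ (assoc _ _ _)) ⟩
    g ∙ x ∙ (g ⁻¹ ∙ (g ∙ (y ∙ g ⁻¹))) ≈⟨ ∙-congˡ (\\-leftDividesʳ g _) ⟩
    g ∙ x ∙ (y ∙ g ⁻¹)               ≈⟨ assoc _ _ _ ⟨
    g ∙ x ∙ y ∙ g ⁻¹                 ≈⟨ ∙-congʳ (assoc _ _ _) ⟩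
    g ∙ (x ∙ y) ∙ g ⁻¹               ∎)

  conjugate-ε : ∀ g → conjugate g ε ≈ ε
  conjugate-ε g = trans (∙-congʳ (identityʳ g)) (inverseʳ g)

  conjugate-⁻¹ : ∀ g x → conjugate g (x ⁻¹) ≈ conjugate g x ⁻¹
  conjugate-⁻¹ g x = inverseˡ-unique _ _
    (trans (sym (conjugate-∙ g _ _)) (trans (conjugate-cong refl (inverseˡ x)) (conjugate-ε g)))

  conjugate-comp : ∀ g h x → conjugate (g ∙ h) x ≈ conjugate g (conjugate h x)
  conjugate-comp g h x = begin
    g ∙ h ∙ x ∙ (g ∙ h) ⁻¹         ≈⟨ ∙-cong (assoc _ _ _) (⁻¹-anti-homo-∙ g h) ⟩
    g ∙ (h ∙ x) ∙ (h ⁻¹ ∙ g ⁻¹)    ≈⟨ assoc _ _ _ ⟨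
    g ∙ (h ∙ x) ∙ h ⁻¹ ∙ g ⁻¹      ≈⟨ ∙-congʳ (assoc _ _ _) ⟩
    g ∙ (h ∙ x ∙ h ⁻¹) ∙ g ⁻¹      ∎

  conjugate-id : ∀ x → conjugate ε x ≈ x
  conjugate-id x = trans (∙-cong (identityˡ x) ε⁻¹≈ε) (identityʳ x)

  -- gJg⁻¹
  conjSub : Carrier → Sub → Sub
  conjSub g J = record
    { Mem  = λ x → conjugate (g ⁻¹) x ∈ Mem J
    ; resp = λ x≈y → resp J (conjugate-cong refl x≈y)
    ; ε∈   = resp J (sym (conjugate-ε _)) (ε∈ J)
    ; ∙∈   = λ p q → resp J (sym (conjugate-∙ _ _ _)) (∙∈ J p q)
    ; ⁻¹∈  = λ p → resp J (sym (conjugate-⁻¹ _ _)) (⁻¹∈ J p)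
    }

  normalizer : Sub → Sub
  normalizer J = record
    { Mem  = λ g → Mem (conjSub g J) ≐ Mem J
    ; resp = λ g≈h (p , q) →
        (λ a → p (resp J (conjugate-cong (⁻¹-cong (sym g≈h)) refl) a)) ,
        (λ a → resp J (conjugate-cong (⁻¹-cong g≈h) refl) (q a))
    ; ε∈   =
        (λ a → resp J (trans (conjugate-cong ε⁻¹≈ε refl) (conjugate-id _)) a) ,
        (λ a → resp J (sym (trans (conjugate-cong ε⁻¹≈ε refl) (conjugate-id _))) a)
    ; ∙∈   = λ {g} {h} (p , q) (p′ , q′) →
        let e = λ x → trans (conjugate-cong {x = x} (⁻¹-anti-homo-∙ g h) refl)
                            (conjugate-comp (h ⁻¹) (g ⁻¹) x) in
        (λ {x} a → p (p′ (resp J (e x) a))) ,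
        (λ {x} a → resp J (sym (e x)) (q′ (q a)))
    ; ⁻¹∈  = λ {g} (p , q) →
        let e = λ x → trans (sym (conjugate-comp (g ⁻¹) (g ⁻¹ ⁻¹) x))
                      (trans (conjugate-cong (inverseʳ _) refl) (conjugate-id x)) in
        (λ {x} a → resp J (e x) (q a)) ,
        (λ {x} a → p (resp J (sym (e x)) a))
    }

  ⊆-normalizer : ∀ J → Mem J ⊆ Mem (normalizer J)
  ⊆-normalizer J {g} g∈ =
    (λ {x} a → resp J
        (trans (sym (conjugate-comp g (g ⁻¹) x))
          (trans (conjugate-cong (inverseʳ g) refl) (conjugate-id x)))
        (∙∈ J (∙∈ J g∈ a) (⁻¹∈ J g∈))) ,
    (λ a → ∙∈ J (∙∈ J (⁻¹∈ J g∈) a) (⁻¹∈ J (⁻¹∈ J g∈)))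

  translateʳ-open : ∀ {U} → IsOpen U → ∀ y → IsOpen (λ x → x ∙ y ∈ U)
  translateʳ-open {U} o y = open-resp-≐
    ((λ ((_ , ay) , x∈V) → nbhd-⊆ ay x∈V) , (λ {x} xy → (x , xy) , ∈-nbhd xy))
    (⋃-open (λ ((_ , ay) : Σ Carrier (λ a → a ∙ y ∈ U)) → nbhd ay) (λ (_ , ay) → nbhd-open ay))
    where
    module _ {a} (ay : a ∙ y ∈ U) where
      nbhd : Pred Carrier ℓ
      nbhd = let V , _ = ∙-continuous o ay in V
      nbhd-open : IsOpen nbhd
      nbhd-open = let _ , _ , V-open , _ = ∙-continuous o ay in V-open
      ∈-nbhd : a ∈ nbhd
      ∈-nbhd = let _ , _ , _ , _ , a∈V , _ = ∙-continuous o ay in a∈V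
      nbhd-⊆ : nbhd ⊆ (λ x → x ∙ y ∈ U)
      nbhd-⊆ x∈V = let _ , _ , _ , _ , _ , y∈W , VW = ∙-continuous o ay in VW x∈V y∈W

  translateˡ-open : ∀ {U} → IsOpen U → ∀ y → IsOpen (λ x → y ∙ x ∈ U)
  translateˡ-open o y = open-resp-≐
    ((λ {x} p → open-resp-≈ o (e x) p) , (λ {x} p → open-resp-≈ o (sym (e x)) p))
    (⁻¹-continuous (translateʳ-open (⁻¹-continuous o) (y ⁻¹)))
    where
    e : ∀ x → (x ⁻¹ ∙ y ⁻¹) ⁻¹ ≈ y ∙ x
    e x = trans (⁻¹-cong (sym (⁻¹-anti-homo-∙ y x))) (⁻¹-involutive _)

  conjSub-open : ∀ g {J} → IsOpen (Mem J) → IsOpen (Mem (conjSub g J))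
  conjSub-open g o = translateˡ-open (translateʳ-open o _) _

  normalizer-open : ∀ {J} → IsOpen (Mem J) → IsOpen (Mem (normalizer J))
  normalizer-open {J} o = open-resp-≐
    ((λ ((_ , n∈N) , p) → resp N (//-rightDividesˡ _ _) (∙∈ N (⊆-normalizer J p) n∈N)) ,
     (λ {x} x∈N → (x , x∈N) , resp J (sym (inverseʳ x)) (ε∈ J)))
    (⋃-open (λ ((n , _) : Σ Carrier (Mem N)) x → x ∙ n ⁻¹ ∈ Mem J)
            (λ _ → translateʳ-open o _))
    where N = normalizer J

  _∩ₛ_ : OpenSubgroup → OpenSubgroup → OpenSubgroup
  U ∩ₛ V = record
    { sub = record
      { Mem  = U.Mem ∩ V.Mem
      ; resp = λ e (p , q) → U.resp e p , V.resp e q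
      ; ε∈   = U.ε∈ , V.ε∈
      ; ∙∈   = λ (p , q) (p′ , q′) → U.∙∈ p p′ , V.∙∈ q q′
      ; ⁻¹∈  = λ (p , q) → U.⁻¹∈ p , V.⁻¹∈ q }
    ; is-open = ∩-open U.is-open V.is-open }
    where module U = OpenSubgroup U
          module V = OpenSubgroup V

  wholeOpen : OpenSubgroup
  wholeOpen = record { sub = whole ; is-open = ⊤-open }

  conjOpen : Carrier → OpenSubgroup → OpenSubgroup
  conjOpen g U = record { sub = conjSub g sub ; is-open = conjSub-open g {sub} is-open }
    where open OpenSubgroup U

  El : Sub → Set ℓ
  El J = ∃ (Mem J)

  mul : ∀ J → El J → El J → El J
  mul J (x , p) (y , q) = x ∙ y , ∙∈ J p q

  infixl 7 mul
  syntax mul J x y = x ·[ J ] y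

  1[_] : ∀ J → El J
  1[ J ] = ε , ε∈ J

module Representations {ℓ} (G : LocallyProfiniteGroup ℓ) (C : Field ℓ) where
  open LocallyProfiniteGroup G
  open GroupProperties group
  open Subgroups G
  open Subgroup using (Mem)
  private
    module C = Field C
    L = suc ℓ

  -- Vectors live one universe above G and C because an element of a compact
  -- induction carries an open subgroup of G fixing it.
  VectorSpace : Set (suc L)
  VectorSpace = LeftModule C.ring L L

  record Rep (J : Sub) : Set (suc L) where
    field
      space : VectorSpace
    open LeftModule space public
      using (Carrierᴹ; _≈ᴹ_; _+ᴹ_; _*ₗ_; 0ᴹ; -ᴹ_; ≈ᴹ-refl; ≈ᴹ-sym; ≈ᴹ-trans; ≈ᴹ-setoid)
    infixr 8 _▷_
    field
      _▷_    : El J → Carrierᴹ → Carrierᴹ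
      ▷-cong : ∀ {x y v w} → proj₁ x ≈ proj₁ y → v ≈ᴹ w → x ▷ v ≈ᴹ y ▷ w
      ▷-+    : ∀ x v w → x ▷ (v +ᴹ w) ≈ᴹ x ▷ v +ᴹ x ▷ w
      ▷-*    : ∀ x c v → x ▷ (c *ₗ v) ≈ᴹ c *ₗ (x ▷ v)
      ▷-ε    : ∀ v → 1[ J ] ▷ v ≈ᴹ v
      ▷-·    : ∀ x y v → (x ·[ J ] y) ▷ v ≈ᴹ x ▷ y ▷ v
      smooth : ∀ v → ∃ λ (U : OpenSubgroup) →
                 ∀ x → proj₁ x ∈ OpenSubgroup.Mem U → x ▷ v ≈ᴹ v

    ▷-0 : ∀ x → x ▷ 0ᴹ ≈ᴹ 0ᴹ
    ▷-0 x = M.≈ᴹ-trans (▷-cong refl (M.≈ᴹ-sym (M.*ₗ-zeroˡ 0ᴹ)))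
              (M.≈ᴹ-trans (▷-* x C.0# 0ᴹ) (M.*ₗ-zeroˡ _))
      where module M = LeftModule space

    ▷-neg : ∀ x v → x ▷ (-ᴹ v) ≈ᴹ -ᴹ (x ▷ v)
    ▷-neg x v = GroupProperties.inverseˡ-unique M.+ᴹ-group _ _
      (M.≈ᴹ-trans (M.≈ᴹ-sym (▷-+ x (-ᴹ v) v))
        (M.≈ᴹ-trans (▷-cong refl (M.-ᴹ‿inverseˡ v)) (▷-0 x)))
      where module M = LeftModule space

  open Rep

  module _ {J : Sub} where

    record Hom (V W : Rep J) : Set L where
      private module V = Rep V
              module W = Rep W
      field
        ⟦_⟧    : V.Carrierᴹ → W.Carrierᴹ
        ⟦⟧-cong : ∀ {v w} → v V.≈ᴹ w → ⟦ v ⟧ W.≈ᴹ ⟦ w ⟧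
        homo-+ : ∀ v w → ⟦ v V.+ᴹ w ⟧ W.≈ᴹ ⟦ v ⟧ W.+ᴹ ⟦ w ⟧
        homo-* : ∀ c v → ⟦ c V.*ₗ v ⟧ W.≈ᴹ c W.*ₗ ⟦ v ⟧
        homo-▷ : ∀ x v → ⟦ x V.▷ v ⟧ W.≈ᴹ x W.▷ ⟦ v ⟧

    _≈ₕ_ : ∀ {V W} → Rel (Hom V W) L
    _≈ₕ_ {V} {W} φ ψ = ∀ v → _≈ᴹ_ W (Hom.⟦_⟧ φ v) (Hom.⟦_⟧ ψ v)

    infix 4 _≅_
    record _≅_ (V W : Rep J) : Set L where
      field
        to   : Hom V W
        from : Hom W V
        to∘from : ∀ w → _≈ᴹ_ W (Hom.⟦_⟧ to (Hom.⟦_⟧ from w)) w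
        from∘to : ∀ v → _≈ᴹ_ V (Hom.⟦_⟧ from (Hom.⟦_⟧ to v)) v

    ≅-sym : ∀ {V W} → V ≅ W → W ≅ V
    ≅-sym f = record { to = from ; from = to ; to∘from = from∘to ; from∘to = to∘from }
      where open _≅_ f

    Hom-comp : ∀ {U V W} → Hom V W → Hom U V → Hom U W
    Hom-comp {U} {V} {W} ψ φ = record
      { ⟦_⟧ = ψ.⟦_⟧ ∘ φ.⟦_⟧
      ; ⟦⟧-cong = ψ.⟦⟧-cong ∘ φ.⟦⟧-cong
      ; homo-+ = λ v w → ≈ᴹ-trans W (ψ.⟦⟧-cong (φ.homo-+ v w)) (ψ.homo-+ _ _)
      ; homo-* = λ c v → ≈ᴹ-trans W (ψ.⟦⟧-cong (φ.homo-* c v)) (ψ.homo-* _ _)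
      ; homo-▷ = λ x v → ≈ᴹ-trans W (ψ.⟦⟧-cong (φ.homo-▷ x v)) (ψ.homo-▷ _ _) }
      where module φ = Hom φ
            module ψ = Hom ψ

    ≅-trans : ∀ {U V W} → U ≅ V → V ≅ W → U ≅ W
    ≅-trans {U} {V} {W} f g = record
      { to = Hom-comp g.to f.to
      ; from = Hom-comp f.from g.from
      ; to∘from = λ w → ≈ᴹ-trans W (Hom.⟦⟧-cong g.to (f.to∘from _)) (g.to∘from w)
      ; from∘to = λ v → ≈ᴹ-trans U (Hom.⟦⟧-cong f.from (g.from∘to _)) (f.from∘to v) }
      where module f = _≅_ f
            module g = _≅_ g

    record Subrep (V : Rep J) : Set (suc L) where
      private module V = Rep V
      field
        Memᵥ  : Pred V.Carrierᴹ L
        respᵥ : Memᵥ Respects V._≈ᴹ_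
        0∈    : V.0ᴹ ∈ Memᵥ
        +∈    : ∀ {v w} → v ∈ Memᵥ → w ∈ Memᵥ → v V.+ᴹ w ∈ Memᵥ
        *∈    : ∀ c {v} → v ∈ Memᵥ → c V.*ₗ v ∈ Memᵥ
        ▷∈    : ∀ x {v} → v ∈ Memᵥ → x V.▷ v ∈ Memᵥ

    Irreducible : Rep J → Set (suc L)
    Irreducible V =
      (∃ λ v → ¬ (v V.≈ᴹ V.0ᴹ)) ×
      (∀ (W : Subrep V) → (∀ {v} → v ∈ Subrep.Memᵥ W → v V.≈ᴹ V.0ᴹ) ⊎ (∀ v → v ∈ Subrep.Memᵥ W))
      where module V = Rep V

  restrict : ∀ {J K} → Mem J ⊆ Mem K → Rep K → Rep J
  restrict {J} {K} J⊆K V = record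
    { space = V.space
    ; _▷_ = λ x → ι x V.▷_
    ; ▷-cong = V.▷-cong
    ; ▷-+ = λ x → V.▷-+ (ι x)
    ; ▷-* = λ x → V.▷-* (ι x)
    ; ▷-ε = λ v → V.≈ᴹ-trans (V.▷-cong refl V.≈ᴹ-refl) (V.▷-ε v)
    ; ▷-· = λ x y v → V.≈ᴹ-trans (V.▷-cong refl V.≈ᴹ-refl) (V.▷-· (ι x) (ι y) v)
    ; smooth = λ v → let U , fix = V.smooth v in U , λ x → fix (ι x) }
    where
    module V = Rep V
    ι : El J → El K
    ι (x , p) = x , J⊆K p

  -- The representation x ↦ g⁻¹xg of gJg⁻¹ on the space of V.
  conjRep : ∀ g {J} → Rep J → Rep (conjSub g J)
  conjRep g {J} V = record
    { space = V.space
    ; _▷_ = λ x → c x V.▷_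
    ; ▷-cong = λ p → V.▷-cong (conjugate-cong refl p)
    ; ▷-+ = λ x → V.▷-+ (c x)
    ; ▷-* = λ x → V.▷-* (c x)
    ; ▷-ε = λ v → V.≈ᴹ-trans (V.▷-cong (conjugate-ε _) V.≈ᴹ-refl) (V.▷-ε v)
    ; ▷-· = λ x y v → V.≈ᴹ-trans (V.▷-cong (conjugate-∙ _ _ _) V.≈ᴹ-refl) (V.▷-· (c x) (c y) v)
    ; smooth = λ v → let U , fix = V.smooth v in conjOpen g U , λ x → fix (c x) }
    where
    module V = Rep V
    c : El (conjSub g J) → El J
    c (x , p) = conjugate (g ⁻¹) x , p

  module _ {J K : Sub} (J⊆K : Mem J ⊆ Mem K) (V : Rep J) where
    private
      module V = Rep V
      module M = LeftModule V.space

    incl : El J → El K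
    incl (x , p) = x , J⊆K p

    -- Used for open J and K only: K is then closed in G and carries the subspace
    -- topology, so smoothness and compactness modulo J can be tested in G.
    -- The clause `supported` says that the support lies in a set compact modulo
    -- J; as J is open, the support is closed and so is itself compact modulo J.
    record IndCarrier : Set L where
      field
        fun         : El K → V.Carrierᴹ
        fun-cong    : ∀ {x y} → proj₁ x ≈ proj₁ y → fun x V.≈ᴹ fun y
        equivariant : ∀ j x → fun (incl j ·[ K ] x) V.≈ᴹ j V.▷ fun x
        stabilizer  : ∃ λ (U : OpenSubgroup) → ∀ x u → proj₁ u ∈ OpenSubgroup.Mem U →
                        fun (x ·[ K ] u) V.≈ᴹ fun x
        supported   : ∃ λ (S : Pred Carrier ℓ) → IsCompactMod J S ×
                        (∀ x → ¬ (proj₁ x ∈ S) → fun x V.≈ᴹ V.0ᴹ)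
    open IndCarrier

    ∅-compact : IsCompactMod J (λ _ → ⊥ {ℓ})
    ∅-compact F _ _ _ = [] , λ ()

    ∪-compact : ∀ {S T : Pred Carrier ℓ} → IsCompactMod J S → IsCompactMod J T → IsCompactMod J (S ∪ T)
    ∪-compact cS cT F o st cov =
      let is , p = cS F o st (λ s → cov (inj₁ s))
          js , q = cT F o st (λ t → cov (inj₂ t))
      in is ++ js , λ { (inj₁ s) → ++⁺ˡ (p s) ; (inj₂ t) → ++⁺ʳ is (q t) }

    translate-compact : ∀ {S : Pred Carrier ℓ} y → IsCompactMod J S → IsCompactMod J (λ x → ∃ λ s → s ∈ S × s ≈ x ∙ y)
    translate-compact {S} y c F o st cov =
      let is , p = c (λ i x → x ∙ y ⁻¹ ∈ F i) (λ i → translateʳ-open (o i) _)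
                     (λ i j∈ x∈ → open-resp-≈ (o i) (sym (assoc _ _ _)) (st i j∈ x∈))
                     (λ {s} s∈ → cov (s , s∈ , sym (//-rightDividesˡ y s)))
      in is , λ (s , s∈ , e) →
           Any.map (λ {i} → open-resp-≈ (o i) (trans (∙-congʳ e) (//-rightDividesʳ y _))) (p s∈)

    _+ᵢ_ : IndCarrier → IndCarrier → IndCarrier
    f +ᵢ g = record
      { fun = λ x → fun f x V.+ᴹ fun g x
      ; fun-cong = λ e → M.+ᴹ-cong (fun-cong f e) (fun-cong g e)
      ; equivariant = λ j x →
          M.≈ᴹ-trans (M.+ᴹ-cong (equivariant f j x) (equivariant g j x)) (M.≈ᴹ-sym (V.▷-+ j _ _))
      ; stabilizer = let U , p = stabilizer f ; W , q = stabilizer g in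
          (U ∩ₛ W) , λ x u (a , b) → M.+ᴹ-cong (p x u a) (q x u b)
      ; supported = let S , cS , p = supported f ; T , cT , q = supported g in
          S ∪ T , ∪-compact cS cT , λ x n → M.≈ᴹ-trans
            (M.+ᴹ-cong (p x (λ s → n (inj₁ s))) (q x (λ t → n (inj₂ t)))) (M.+ᴹ-identityˡ _) }

    0ᵢ : IndCarrier
    0ᵢ = record
      { fun = λ _ → V.0ᴹ
      ; fun-cong = λ _ → M.≈ᴹ-refl
      ; equivariant = λ j _ → M.≈ᴹ-sym (V.▷-0 j)
      ; stabilizer = wholeOpen , λ _ _ _ → M.≈ᴹ-refl
      ; supported = (λ _ → ⊥) , ∅-compact , λ _ _ → M.≈ᴹ-refl }

    pointwise : (h : V.Carrierᴹ → V.Carrierᴹ) → (∀ {v w} → v V.≈ᴹ w → h v V.≈ᴹ h w) →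
                (∀ j v → h (j V.▷ v) V.≈ᴹ j V.▷ h v) → h V.0ᴹ V.≈ᴹ V.0ᴹ → IndCarrier → IndCarrier
    pointwise h h-cong h-▷ h-0 f = record
      { fun = λ x → h (fun f x)
      ; fun-cong = λ e → h-cong (fun-cong f e)
      ; equivariant = λ j x → M.≈ᴹ-trans (h-cong (equivariant f j x)) (h-▷ j _)
      ; stabilizer = let U , p = stabilizer f in U , λ x u a → h-cong (p x u a)
      ; supported = let S , c , p = supported f in
          S , c , λ x n → M.≈ᴹ-trans (h-cong (p x n)) h-0 }

    -ᵢ_ : IndCarrier → IndCarrier
    -ᵢ_ = pointwise V.-ᴹ_ M.-ᴹ‿cong (λ j v → M.≈ᴹ-sym (V.▷-neg j v))
      (GroupProperties.ε⁻¹≈ε M.+ᴹ-group)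

    _*ᵢ_ : C.Carrier → IndCarrier → IndCarrier
    c *ᵢ f = pointwise (c V.*ₗ_) (M.*ₗ-cong C.refl) (λ j v → M.≈ᴹ-sym (V.▷-* j c v)) (M.*ₗ-zeroʳ c) f

    translate : El K → IndCarrier → IndCarrier
    translate (k , k∈) f = record
      { fun = λ x → fun f (x ·[ K ] (k , k∈))
      ; fun-cong = λ e → fun-cong f (∙-congʳ e)
      ; equivariant = λ j x → M.≈ᴹ-trans (fun-cong f (assoc _ _ _)) (equivariant f j _)
      ; stabilizer = let U , p = stabilizer f in
          conjOpen k U , λ x (u , u∈) a → M.≈ᴹ-trans
            (fun-cong f (e (proj₁ x) u))
            (p (x ·[ K ] (k , k∈))
               (conjugate (k ⁻¹) u , Subgroup.∙∈ K (Subgroup.∙∈ K k⁻¹∈ u∈) (Subgroup.⁻¹∈ K k⁻¹∈)) a)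
      ; supported = let S , c , p = supported f in
          _ , translate-compact k c , λ x n → p _ (λ s → n (_ , s , refl)) }
      where
      k⁻¹∈ = Subgroup.⁻¹∈ K k∈
      e : ∀ x u → x ∙ u ∙ k ≈ x ∙ k ∙ conjugate (k ⁻¹) u
      e x u = sym (begin
        x ∙ k ∙ (k ⁻¹ ∙ u ∙ k ⁻¹ ⁻¹)    ≈⟨ ∙-congˡ (∙-cong refl (⁻¹-involutive k)) ⟩
        x ∙ k ∙ (k ⁻¹ ∙ u ∙ k)          ≈⟨ ∙-congˡ (assoc _ _ _) ⟩
        x ∙ k ∙ (k ⁻¹ ∙ (u ∙ k))        ≈⟨ assoc _ _ _ ⟩
        x ∙ (k ∙ (k ⁻¹ ∙ (u ∙ k)))      ≈⟨ ∙-congˡ (\\-leftDividesˡ k _) ⟩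
        x ∙ (u ∙ k)                     ≈⟨ assoc _ _ _ ⟨
        x ∙ u ∙ k                       ∎)
        where open SetoidReasoning setoid

    Ind : Rep K
    Ind = record
      { space = record
        { Carrierᴹ = IndCarrier
        ; _≈ᴹ_ = λ f g → ∀ x → fun f x V.≈ᴹ fun g x
        ; _+ᴹ_ = _+ᵢ_
        ; _*ₗ_ = _*ᵢ_
        ; 0ᴹ = 0ᵢ
        ; -ᴹ_ = -ᵢ_
        ; isLeftModule = record
          { isLeftSemimodule = record
            { +ᴹ-isCommutativeMonoid = record
              { isMonoid = record
                { isSemigroup = record
                  { isMagma = record
                    { isEquivalence = record
                      { refl = λ _ → M.≈ᴹ-refl
                      ; sym = λ p x → M.≈ᴹ-sym (p x)
                      ; trans = λ p q x → M.≈ᴹ-trans (p x) (q x) }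
                    ; ∙-cong = λ p q x → M.+ᴹ-cong (p x) (q x) }
                  ; assoc = λ _ _ _ _ → M.+ᴹ-assoc _ _ _ }
                ; identity = (λ _ _ → M.+ᴹ-identityˡ _) , (λ _ _ → M.+ᴹ-identityʳ _) }
              ; comm = λ _ _ _ → M.+ᴹ-comm _ _ }
            ; isPreleftSemimodule = record
              { *ₗ-cong = λ p q x → M.*ₗ-cong p (q x)
              ; *ₗ-zeroˡ = λ _ _ → M.*ₗ-zeroˡ _
              ; *ₗ-distribʳ = λ _ _ _ _ → M.*ₗ-distribʳ _ _ _
              ; *ₗ-identityˡ = λ _ _ → M.*ₗ-identityˡ _
              ; *ₗ-assoc = λ _ _ _ _ → M.*ₗ-assoc _ _ _
              ; *ₗ-zeroʳ = λ _ _ → M.*ₗ-zeroʳ _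
              ; *ₗ-distribˡ = λ _ _ _ _ → M.*ₗ-distribˡ _ _ _ } }
          ; -ᴹ‿cong = λ p x → M.-ᴹ‿cong (p x)
          ; -ᴹ‿inverse = (λ _ _ → M.-ᴹ‿inverseˡ _) , (λ _ _ → M.-ᴹ‿inverseʳ _) } }
      ; _▷_ = translate
      ; ▷-cong = λ {_} {_} {f} e p x → M.≈ᴹ-trans (fun-cong f (∙-congˡ e)) (p _)
      ; ▷-+ = λ _ _ _ _ → M.≈ᴹ-refl
      ; ▷-* = λ _ _ _ _ → M.≈ᴹ-refl
      ; ▷-ε = λ f x → fun-cong f (identityʳ _)
      ; ▷-· = λ _ _ f _ → fun-cong f (sym (assoc _ _ _))
      ; smooth = λ f → let U , p = stabilizer f in U , λ u u∈ x → p x u u∈ }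

  Ind-map : ∀ {J K} (J⊆K : Mem J ⊆ Mem K) {V W : Rep J} →
            Hom V W → Hom (Ind {J} {K} J⊆K V) (Ind {J} {K} J⊆K W)
  Ind-map {J} {K} J⊆K {V} {W} φ = record
    { ⟦_⟧ = λ f → let open IndCarrier f in record
        { fun = φ.⟦_⟧ ∘ fun
        ; fun-cong = λ e → φ.⟦⟧-cong (fun-cong e)
        ; equivariant = λ j x → W.≈ᴹ-trans (φ.⟦⟧-cong (equivariant j x)) (φ.homo-▷ j _)
        ; stabilizer = let U , p = stabilizer in U , λ x u a → φ.⟦⟧-cong (p x u a)
        ; supported = let S , c , p = supported in
            S , c , λ x n → W.≈ᴹ-trans (φ.⟦⟧-cong (p x n)) φ-0 }
    ; ⟦⟧-cong = λ p x → φ.⟦⟧-cong (p x)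
    ; homo-+ = λ _ _ _ → φ.homo-+ _ _
    ; homo-* = λ _ _ _ → φ.homo-* _ _
    ; homo-▷ = λ _ _ _ → W.≈ᴹ-refl }
    where
    module φ = Hom φ
    module V = Rep V
    module W = Rep W
    φ-0 : φ.⟦ V.0ᴹ ⟧ W.≈ᴹ W.0ᴹ
    φ-0 = W.≈ᴹ-trans (φ.⟦⟧-cong (V.≈ᴹ-sym (LeftModule.*ₗ-zeroˡ V.space V.0ᴹ)))
            (W.≈ᴹ-trans (φ.homo-* _ _) (LeftModule.*ₗ-zeroˡ W.space _))

  module _ (σ : Automorphism C) {J : Sub} (V : Rep J) where
    private
      module σ = Automorphism σ
      module V = Rep V
      module M = LeftModule V.space

    -- σ(V) = C ⊗_{σ,C} V, presented by generators and relations: c σ(a) ⊗ v = c ⊗ a v.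
    infixl 6 _⊕_
    infix  7 _⊗_
    data Tensor : Set L where
      _⊗_ : C.Carrier → V.Carrierᴹ → Tensor
      _⊕_ : Tensor → Tensor → Tensor
      𝟘   : Tensor
      ⊖_  : Tensor → Tensor

    infix 4 _∼_
    data _∼_ : Tensor → Tensor → Set L where
      ∼-refl      : ∀ {s} → s ∼ s
      ∼-sym       : ∀ {s t} → s ∼ t → t ∼ s
      ∼-trans     : ∀ {s t u} → s ∼ t → t ∼ u → s ∼ u
      ⊗-cong      : ∀ {c d v w} → c C.≈ d → v V.≈ᴹ w → c ⊗ v ∼ d ⊗ w
      ⊕-cong      : ∀ {s s′ t t′} → s ∼ s′ → t ∼ t′ → s ⊕ t ∼ s′ ⊕ t′
      ⊖-cong      : ∀ {s t} → s ∼ t → ⊖ s ∼ ⊖ t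
      ⊕-assoc     : ∀ s t u → s ⊕ t ⊕ u ∼ s ⊕ (t ⊕ u)
      ⊕-comm      : ∀ s t → s ⊕ t ∼ t ⊕ s
      ⊕-identityˡ : ∀ s → 𝟘 ⊕ s ∼ s
      ⊖-inverseˡ  : ∀ s → (⊖ s) ⊕ s ∼ 𝟘
      ⊗-addˡ      : ∀ c d v → (c C.+ d) ⊗ v ∼ c ⊗ v ⊕ d ⊗ v
      ⊗-addʳ      : ∀ c v w → c ⊗ (v V.+ᴹ w) ∼ c ⊗ v ⊕ c ⊗ w
      ⊗-balanced  : ∀ c a v → (c C.* σ.⟦ a ⟧) ⊗ v ∼ c ⊗ (a V.*ₗ v)

    tensorAbelian : AbelianGroup L L
    tensorAbelian = record
      { Carrier = Tensor ; _≈_ = _∼_ ; _∙_ = _⊕_ ; ε = 𝟘 ; _⁻¹ = ⊖_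
      ; isAbelianGroup = record
        { isGroup = record
          { isMonoid = record
            { isSemigroup = record
              { isMagma = record
                { isEquivalence = record { refl = ∼-refl ; sym = ∼-sym ; trans = ∼-trans }
                ; ∙-cong = ⊕-cong }
              ; assoc = ⊕-assoc }
            ; identity = ⊕-identityˡ , (λ s → ∼-trans (⊕-comm s 𝟘) (⊕-identityˡ s)) }
          ; inverse = ⊖-inverseˡ , (λ s → ∼-trans (⊕-comm s (⊖ s)) (⊖-inverseˡ s))
          ; ⁻¹-cong = ⊖-cong }
        ; comm = ⊕-comm } }

    private
      module T = AbelianGroup tensorAbelian
      module TP = AbelianGroupProperties tensorAbelian
      module CS = CommutativeSemigroupProperties T.commutativeSemigroup

    0⊗ : ∀ v → C.0# ⊗ v ∼ 𝟘
    0⊗ v = TP.identityʳ-unique _ _ (∼-trans (∼-sym (⊗-addˡ _ _ v)) (⊗-cong (C.+-identityˡ _) M.≈ᴹ-refl))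

    scale : C.Carrier → Tensor → Tensor
    scale c (d ⊗ v) = (c C.* d) ⊗ v
    scale c (s ⊕ t) = scale c s ⊕ scale c t
    scale c 𝟘       = 𝟘
    scale c (⊖ s)   = ⊖ scale c s

    scale-congˡ : ∀ {c d} s → c C.≈ d → scale c s ∼ scale d s
    scale-congˡ (e ⊗ v) p = ⊗-cong (C.*-congʳ p) M.≈ᴹ-refl
    scale-congˡ (s ⊕ t) p = ⊕-cong (scale-congˡ s p) (scale-congˡ t p)
    scale-congˡ 𝟘       p = ∼-refl
    scale-congˡ (⊖ s)   p = ⊖-cong (scale-congˡ s p)

    scale-congʳ : ∀ c {s t} → s ∼ t → scale c s ∼ scale c t
    scale-congʳ c ∼-refl = ∼-refl
    scale-congʳ c (∼-sym p) = ∼-sym (scale-congʳ c p)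
    scale-congʳ c (∼-trans p q) = ∼-trans (scale-congʳ c p) (scale-congʳ c q)
    scale-congʳ c (⊗-cong p q) = ⊗-cong (C.*-congˡ p) q
    scale-congʳ c (⊕-cong p q) = ⊕-cong (scale-congʳ c p) (scale-congʳ c q)
    scale-congʳ c (⊖-cong p) = ⊖-cong (scale-congʳ c p)
    scale-congʳ c (⊕-assoc s t u) = ⊕-assoc _ _ _
    scale-congʳ c (⊕-comm s t) = ⊕-comm _ _
    scale-congʳ c (⊕-identityˡ s) = ⊕-identityˡ _
    scale-congʳ c (⊖-inverseˡ s) = ⊖-inverseˡ _
    scale-congʳ c (⊗-addˡ d e v) = ∼-trans (⊗-cong (C.distribˡ _ _ _) M.≈ᴹ-refl) (⊗-addˡ _ _ _)
    scale-congʳ c (⊗-addʳ d v w) = ⊗-addʳ _ _ _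
    scale-congʳ c (⊗-balanced d a v) =
      ∼-trans (⊗-cong (C.sym (C.*-assoc _ _ _)) M.≈ᴹ-refl) (⊗-balanced _ _ _)

    scale-cong : ∀ {c d s t} → c C.≈ d → s ∼ t → scale c s ∼ scale d t
    scale-cong {c} {d} {s} {t} p q = ∼-trans (scale-congˡ s p) (scale-congʳ d q)

    scale-0 : ∀ s → scale C.0# s ∼ 𝟘
    scale-0 (c ⊗ v) = ∼-trans (⊗-cong (C.zeroˡ c) M.≈ᴹ-refl) (0⊗ v)
    scale-0 (s ⊕ t) = ∼-trans (⊕-cong (scale-0 s) (scale-0 t)) (⊕-identityˡ 𝟘)
    scale-0 𝟘       = ∼-refl
    scale-0 (⊖ s)   = ∼-trans (⊖-cong (scale-0 s)) TP.ε⁻¹≈ε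

    scale-+ : ∀ s c d → scale (c C.+ d) s ∼ scale c s ⊕ scale d s
    scale-+ (e ⊗ v) c d = ∼-trans (⊗-cong (C.distribʳ _ _ _) M.≈ᴹ-refl) (⊗-addˡ _ _ _)
    scale-+ (s ⊕ t) c d = ∼-trans (⊕-cong (scale-+ s c d) (scale-+ t c d)) (CS.interchange _ _ _ _)
    scale-+ 𝟘       c d = ∼-sym (⊕-identityˡ 𝟘)
    scale-+ (⊖ s)   c d = ∼-trans (⊖-cong (scale-+ s c d)) (∼-sym (TP.⁻¹-∙-comm _ _))

    scale-1 : ∀ s → scale C.1# s ∼ s
    scale-1 (c ⊗ v) = ⊗-cong (C.*-identityˡ c) M.≈ᴹ-refl
    scale-1 (s ⊕ t) = ⊕-cong (scale-1 s) (scale-1 t)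
    scale-1 𝟘       = ∼-refl
    scale-1 (⊖ s)   = ⊖-cong (scale-1 s)

    scale-* : ∀ c d s → scale (c C.* d) s ∼ scale c (scale d s)
    scale-* c d (e ⊗ v) = ⊗-cong (C.*-assoc _ _ _) M.≈ᴹ-refl
    scale-* c d (s ⊕ t) = ⊕-cong (scale-* c d s) (scale-* c d t)
    scale-* c d 𝟘       = ∼-refl
    scale-* c d (⊖ s)   = ⊖-cong (scale-* c d s)

    act : El J → Tensor → Tensor
    act x (c ⊗ v) = c ⊗ (x V.▷ v)
    act x (s ⊕ t) = act x s ⊕ act x t
    act x 𝟘       = 𝟘
    act x (⊖ s)   = ⊖ act x s

    act-congˡ : ∀ {x y} s → proj₁ x ≈ proj₁ y → act x s ∼ act y s
    act-congˡ (c ⊗ v) p = ⊗-cong C.refl (V.▷-cong p M.≈ᴹ-refl)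
    act-congˡ (s ⊕ t) p = ⊕-cong (act-congˡ s p) (act-congˡ t p)
    act-congˡ 𝟘       p = ∼-refl
    act-congˡ (⊖ s)   p = ⊖-cong (act-congˡ s p)

    act-congʳ : ∀ x {s t} → s ∼ t → act x s ∼ act x t
    act-congʳ x ∼-refl = ∼-refl
    act-congʳ x (∼-sym p) = ∼-sym (act-congʳ x p)
    act-congʳ x (∼-trans p q) = ∼-trans (act-congʳ x p) (act-congʳ x q)
    act-congʳ x (⊗-cong p q) = ⊗-cong p (V.▷-cong refl q)
    act-congʳ x (⊕-cong p q) = ⊕-cong (act-congʳ x p) (act-congʳ x q)
    act-congʳ x (⊖-cong p) = ⊖-cong (act-congʳ x p)
    act-congʳ x (⊕-assoc s t u) = ⊕-assoc _ _ _
    act-congʳ x (⊕-comm s t) = ⊕-comm _ _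
    act-congʳ x (⊕-identityˡ s) = ⊕-identityˡ _
    act-congʳ x (⊖-inverseˡ s) = ⊖-inverseˡ _
    act-congʳ x (⊗-addˡ d e v) = ⊗-addˡ _ _ _
    act-congʳ x (⊗-addʳ d v w) = ∼-trans (⊗-cong C.refl (V.▷-+ x v w)) (⊗-addʳ _ _ _)
    act-congʳ x (⊗-balanced d a v) = ∼-trans (⊗-balanced _ _ _) (⊗-cong C.refl (M.≈ᴹ-sym (V.▷-* x a v)))

    act-scale : ∀ x c s → act x (scale c s) ∼ scale c (act x s)
    act-scale x c (d ⊗ v) = ∼-refl
    act-scale x c (s ⊕ t) = ⊕-cong (act-scale x c s) (act-scale x c t)
    act-scale x c 𝟘       = ∼-refl
    act-scale x c (⊖ s)   = ⊖-cong (act-scale x c s)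

    act-ε : ∀ s → act 1[ J ] s ∼ s
    act-ε (c ⊗ v) = ⊗-cong C.refl (V.▷-ε v)
    act-ε (s ⊕ t) = ⊕-cong (act-ε s) (act-ε t)
    act-ε 𝟘       = ∼-refl
    act-ε (⊖ s)   = ⊖-cong (act-ε s)

    act-· : ∀ x y s → act (x ·[ J ] y) s ∼ act x (act y s)
    act-· x y (c ⊗ v) = ⊗-cong C.refl (V.▷-· x y v)
    act-· x y (s ⊕ t) = ⊕-cong (act-· x y s) (act-· x y t)
    act-· x y 𝟘       = ∼-refl
    act-· x y (⊖ s)   = ⊖-cong (act-· x y s)

    act-smooth : ∀ s → ∃ λ (U : OpenSubgroup) → ∀ x → proj₁ x ∈ OpenSubgroup.Mem U → act x s ∼ s
    act-smooth (c ⊗ v) = let U , p = V.smooth v in U , λ x a → ⊗-cong C.refl (p x a)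
    act-smooth (s ⊕ t) = let U , p = act-smooth s ; W , q = act-smooth t in
      (U ∩ₛ W) , λ x (a , b) → ⊕-cong (p x a) (q x b)
    act-smooth 𝟘       = wholeOpen , λ _ _ → ∼-refl
    act-smooth (⊖ s)   = let U , p = act-smooth s in U , λ x a → ⊖-cong (p x a)

    twist : Rep J
    twist = record
      { space = record
        { Carrierᴹ = Tensor
        ; _≈ᴹ_ = _∼_
        ; _+ᴹ_ = _⊕_
        ; _*ₗ_ = scale
        ; 0ᴹ = 𝟘
        ; -ᴹ_ = ⊖_
        ; isLeftModule = record
          { isLeftSemimodule = record
            { +ᴹ-isCommutativeMonoid = T.isCommutativeMonoid
            ; isPreleftSemimodule = record
              { *ₗ-cong = scale-cong
              ; *ₗ-zeroˡ = scale-0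
              ; *ₗ-distribʳ = scale-+
              ; *ₗ-identityˡ = scale-1
              ; *ₗ-assoc = scale-*
              ; *ₗ-zeroʳ = λ _ → ∼-refl
              ; *ₗ-distribˡ = λ _ _ _ → ∼-refl } }
          ; -ᴹ‿cong = ⊖-cong
          ; -ᴹ‿inverse = T.inverse } }
      ; _▷_ = act
      ; ▷-cong = λ {x} {y} {s} p q → ∼-trans (act-congˡ s p) (act-congʳ y q)
      ; ▷-+ = λ _ _ _ → ∼-refl
      ; ▷-* = act-scale
      ; ▷-ε = act-ε
      ; ▷-· = act-·
      ; smooth = act-smooth }

  module _ (U : Sub) where
    -- xs represents each coset in K/U exactly once.
    IsTransversal : Sub → List Carrier → Set ℓ
    IsTransversal K xs =
      All (Mem K) xs ×
      (∀ {k} → k ∈ Mem K → Any (λ x → x ⁻¹ ∙ k ∈ Mem U) xs) ×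
      AllPairs (λ x y → ¬ (x ⁻¹ ∙ y ∈ Mem U)) xs

  natural : ∀ {A : Set ℓ} → List A → C.Carrier
  natural xs = Multiples._×_ C.+-rawMonoid (length xs) C.1#

  -- Invertibility of all the indices [K : U], U open in K, whose least common
  -- multiple is the pro-order of K.
  InvertibleProOrder : Sub → Set L
  InvertibleProOrder K = ∀ (U : OpenSubgroup) → OpenSubgroup.Mem U ⊆ Mem K → ∀ xs →
    IsTransversal (OpenSubgroup.sub U) K xs → ∃ λ c → natural xs C.* c C.≈ C.1#

  -- e = e_K w, as the average of xw over x ∈ K/U for some open U ⊆ K fixing w.
  IsAverage : (W : Rep whole) → Sub → (w e : Carrierᴹ W) → Set L
  IsAverage W K w e =
    ∃ λ (U : OpenSubgroup) → OpenSubgroup.Mem U ⊆ Mem K ×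
    (∀ x → x ∈ OpenSubgroup.Mem U → (x , tt) W.▷ w W.≈ᴹ w) ×
    ∃₂ λ xs c → IsTransversal (OpenSubgroup.sub U) K xs × natural xs C.* c C.≈ C.1# ×
      e W.≈ᴹ c W.*ₗ foldr W._+ᴹ_ W.0ᴹ (map (λ x → (x , tt) W.▷ w) xs)
    where module W = Rep W

  -- The existence of compact open subgroups of invertible pro-order, without
  -- which the notion is not used, is part of the definition: it is what makes
  -- "K small enough" meaningful.
  ZCompact : Sub → Rep whole → Set L
  ZCompact Z W =
    ∃ λ (K₀ : OpenSubgroup) → IsCompact (OpenSubgroup.Mem K₀) × InvertibleProOrder (OpenSubgroup.sub K₀) ×
    (∀ (K : OpenSubgroup) → IsCompact (OpenSubgroup.Mem K) → OpenSubgroup.Mem K ⊆ OpenSubgroup.Mem K₀ →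
     ∀ w → IsCompactMod Z (λ g → ∃ λ e → IsAverage W (OpenSubgroup.sub K) ((g , tt) W.▷ w) e × ¬ (e W.≈ᴹ W.0ᴹ)))
    where module W = Rep W

  record Pair : Set (suc L) where
    constructor pair
    field
      J      : Sub
      J-open : IsOpen (Mem J)
      V      : Rep J
  open Pair

  -- (J,V) and (J₁,V₁) determine the same subgroup and isomorphism class.
  infix 4 _≅ₚ_
  _≅ₚ_ : Rel Pair L
  P ≅ₚ Q = Σ (Mem (J P) ≐ Mem (J Q)) λ (P⊆Q , _) → V P ≅ restrict P⊆Q (V Q)

  conjPair : Carrier → Pair → Pair
  conjPair g (pair J o V) = pair (conjSub g J) (conjSub-open g {J} o) (conjRep g V)

  ind : Pair → Rep whole
  ind (pair J _ V) = Ind {J} {whole} (λ _ → tt) V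

  IsCType : Pair → Set (suc L)
  IsCType P = Irreducible (V P) × Irreducible (ind P)

  twistPair : Automorphism C → Pair → Pair
  twistPair σ (pair J o V) = pair J o (twist σ V)

  normalizePair : Pair → Pair
  normalizePair (pair J o V) =
    pair (normalizer J) (normalizer-open {J} o) (Ind {J} {normalizer J} (⊆-normalizer J) V)

  record PairSet : Set (suc (suc L)) where
    field
      Memₚ : Pred Pair (suc L)
      resp : ∀ {P Q} → P ≅ₚ Q → P ∈ Memₚ → Q ∈ Memₚ

  record RepSet : Set (suc (suc L)) where
    field
      Memᵣ : Pred (Rep whole) (suc L)
      resp : ∀ {V W} → V ≅ W → V ∈ Memᵣ → W ∈ Memᵣ

  open PairSet using (Memₚ)
  open RepSet using (Memᵣ)

  ≅ₚ-sym : ∀ {P Q} → P ≅ₚ Q → Q ≅ₚ P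
  ≅ₚ-sym {P} {Q} ((P⊆Q , Q⊆P) , f) = (Q⊆P , P⊆Q) , record
    { to = record
      { ⟦_⟧ = from.⟦_⟧ ; ⟦⟧-cong = from.⟦⟧-cong ; homo-+ = from.homo-+ ; homo-* = from.homo-*
      ; homo-▷ = λ (x , x∈) v → ≈ᴹ-trans (V P) (from.⟦⟧-cong (▷-cong (V Q) refl (≈ᴹ-refl (V Q))))
                                  (from.homo-▷ (x , Q⊆P x∈) v) }
    ; from = record
      { ⟦_⟧ = to.⟦_⟧ ; ⟦⟧-cong = to.⟦⟧-cong ; homo-+ = to.homo-+ ; homo-* = to.homo-*
      ; homo-▷ = λ (x , x∈) v → ≈ᴹ-trans (V Q) (to.⟦⟧-cong (▷-cong (V P) refl (≈ᴹ-refl (V P))))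
                                  (≈ᴹ-trans (V Q) (to.homo-▷ (x , Q⊆P x∈) v)
                                    (▷-cong (V Q) refl (≈ᴹ-refl (V Q)))) }
    ; to∘from = from∘to
    ; from∘to = to∘from }
    where
    open _≅_ f
    module to = Hom to
    module from = Hom from

  ≅ₚ-trans : ∀ {P Q R} → P ≅ₚ Q → Q ≅ₚ R → P ≅ₚ R
  ≅ₚ-trans {P} {Q} {R} ((P⊆Q , Q⊆P) , f) ((Q⊆R , R⊆Q) , g) =
    ((λ p → Q⊆R (P⊆Q p)) , (λ r → Q⊆P (R⊆Q r))) , ≅-trans f (record
    { to = record
      { ⟦_⟧ = to.⟦_⟧ ; ⟦⟧-cong = to.⟦⟧-cong ; homo-+ = to.homo-+ ; homo-* = to.homo-*
      ; homo-▷ = λ (x , x∈) → to.homo-▷ (x , P⊆Q x∈) }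
    ; from = record
      { ⟦_⟧ = from.⟦_⟧ ; ⟦⟧-cong = from.⟦⟧-cong ; homo-+ = from.homo-+ ; homo-* = from.homo-*
      ; homo-▷ = λ (x , x∈) → from.homo-▷ (x , P⊆Q x∈) }
    ; to∘from = to∘from
    ; from∘to = from∘to })
    where
    open _≅_ g
    module to = Hom to
    module from = Hom from

  -- 𝔛′, as a set of pairs: that its elements are C-types needs proof.
  normalized : PairSet → PairSet
  normalized 𝔛 = record
    { Memₚ = λ P → ∃ λ Q → Q ∈ Memₚ 𝔛 × P ≅ₚ normalizePair Q
    ; resp = λ {P} {P′} e (Q , Q∈ , f) →
        Q , Q∈ , ≅ₚ-trans {P′} {P} {normalizePair Q} (≅ₚ-sym {P} {P′} e) f }

  ConsistsOfCTypes : PairSet → Set (suc L)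
  ConsistsOfCTypes 𝔛 = ∀ {P} → P ∈ Memₚ 𝔛 → IsCType P

  Intertwining : PairSet → Set (suc L)
  Intertwining 𝔛 = ∀ {P} → P ∈ Memₚ 𝔛 →
    Bijective (_≈ₕ_ {V = V P} {V P}) (_≈ₕ_ {V = ind P} {ind P})
              (Ind-map {J P} {whole} (λ _ → tt) {V P} {V P})

  Unicity : PairSet → Set (suc L)
  Unicity 𝔛 = ∀ {P Q} → P ∈ Memₚ 𝔛 → Q ∈ Memₚ 𝔛 → ind P ≅ ind Q → ∃ λ g → conjPair g P ≅ₚ Q

  Exhaustion : RepSet → PairSet → Set (suc L)
  Exhaustion 𝒵 𝔛 =
    (∀ {P} → P ∈ Memₚ 𝔛 → ind P ∈ Memᵣ 𝒵) ×
    (∀ {W} → W ∈ Memᵣ 𝒵 → ∃ λ P → P ∈ Memₚ 𝔛 × W ≅ ind P)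

  module _ (H : Subgroup (Aut C)) where
    Stable : PairSet → Set (suc L)
    Stable 𝔛 = ∀ {P σ} → P ∈ Memₚ 𝔛 → σ ∈ Mem H → twistPair σ P ∈ Memₚ 𝔛

    -- H-unicity includes H-stability.
    StableUnicity : PairSet → Set (suc L)
    StableUnicity 𝔛 = Stable 𝔛 ×
      (∀ {P σ} → P ∈ Memₚ 𝔛 → σ ∈ Mem H → ind P ≅ ind (twistPair σ P) → V P ≅ twist σ (V P))

{-# OPTIONS --safe #-}
module Submission where

-- By transitivity of compact induction, ind(J′,V′) = ind(J,V), which carries
-- irreducibility and exhaustion over to 𝔛′; a subrepresentation of V′ induces one of
-- ind V′, so V′ is irreducible too. Intertwining is clear because End(V) → End(ind V)
-- factors through End(V′) and End(V′) → End(ind V′) is injective. Induction commutes with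
-- conjugation by g and with twisting by σ, whence unicity and stability. Finally, if
-- ind V′ ≅ ind σ(V′), then unicity for 𝔛 gives g conjugating (J,V) to (J,σ(V)); it
-- normalizes J, so lies in J′, and V′ ≅ gV′ ≅ σ(V′).

open import Defs
open import Defs using () renaming (module Representations to R)
open import Level using (Level)
open import Algebra.Bundles using (Group)
open import Algebra.Module.Bundles using (LeftModule)
import Algebra.Properties.Group as GroupProperties
open import Axiom.ExcludedMiddle using (ExcludedMiddle)
open import Data.List.Base using (List; []; _∷_; map; concatMap)
open import Data.List.Membership.Propositional using (find; lose)
open import Data.List.Relation.Unary.Any as Any using (Any; here; there)
open import Data.List.Relation.Unary.Any.Properties using (map⁺; concatMap⁺)
open import Data.Product.Base using (∃; _×_; _,_; proj₁; proj₂)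
open import Data.Sum.Base using (inj₁; inj₂)
open import Data.Unit.Polymorphic.Base using (tt)
open import Function.Base using (_∘_; id)
open import Function.Definitions using (Injective; Surjective)
open import Relation.Nullary using (¬_; Dec; yes; no; contradiction)
open import Relation.Nullary.Decidable using (decidable-stable)
open import Relation.Unary using (Pred; _∈_; _⊆_; _≐_)

module Types {ℓ} (em : ∀ {a} → ExcludedMiddle a) (G : LocallyProfiniteGroup ℓ) (C : Field ℓ) where
  open LocallyProfiniteGroup G
  open GroupProperties group
  open Subgroups G
  open Subgroup
  open Representations G C hiding (normalizePair; twistPair; conjPair; ind)
  open Rep
  open Pair
  open IndCarrier
  open PairSet using (Memₚ)

  private module C = Field C

  -- Isomorphisms of representations and of pairs.

  module _ {J : Sub} where

    hom-0 : {V W : Rep J} (φ : Hom V W) → _≈ᴹ_ W (Hom.⟦_⟧ φ (0ᴹ V)) (0ᴹ W)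
    hom-0 {V} {W} φ = ≈ᴹ-trans W (φ.⟦⟧-cong (≈ᴹ-sym V (LeftModule.*ₗ-zeroˡ (space V) (0ᴹ V))))
      (≈ᴹ-trans W (φ.homo-* _ _) (LeftModule.*ₗ-zeroˡ (space W) _))
      where module φ = Hom φ

    -- Linearity and equivariance of `inv` come for free: each law is checked after applying `φ`,
    -- which is injective because `left` gives it a left inverse.
    mk≅ : {V W : Rep J} (φ : Hom V W) (inv : Carrierᴹ W → Carrierᴹ V) →
          (∀ {w w′} → _≈ᴹ_ W w w′ → _≈ᴹ_ V (inv w) (inv w′)) →
          (∀ w → _≈ᴹ_ W (Hom.⟦_⟧ φ (inv w)) w) →
          (∀ v → _≈ᴹ_ V (inv (Hom.⟦_⟧ φ v)) v) → V ≅ W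
    mk≅ {V} {W} φ inv inv-cong right left = record
      { to = φ
      ; from = record
        { ⟦_⟧ = inv
        ; ⟦⟧-cong = inv-cong
        ; homo-+ = λ v w → injective (W.≈ᴹ-trans (right _)
            (W.≈ᴹ-sym (W.≈ᴹ-trans (φ.homo-+ _ _) (LeftModule.+ᴹ-cong W.space (right v) (right w)))))
        ; homo-* = λ c v → injective (W.≈ᴹ-trans (right _)
            (W.≈ᴹ-sym (W.≈ᴹ-trans (φ.homo-* _ _) (LeftModule.*ₗ-cong W.space C.refl (right v)))))
        ; homo-▷ = λ x v → injective (W.≈ᴹ-trans (right _)
            (W.≈ᴹ-sym (W.≈ᴹ-trans (φ.homo-▷ _ _) (W.▷-cong refl (right v))))) }
      ; to∘from = right
      ; from∘to = left }
      where
      module φ = Hom φ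
      module V = Rep V
      module W = Rep W
      injective : ∀ {v v′} → φ.⟦ v ⟧ W.≈ᴹ φ.⟦ v′ ⟧ → v V.≈ᴹ v′
      injective p = V.≈ᴹ-trans (V.≈ᴹ-sym (left _)) (V.≈ᴹ-trans (inv-cong p) (left _))

    Irreducible-resp-≅ : {V W : Rep J} → V ≅ W → Irreducible V → Irreducible W
    Irreducible-resp-≅ {V} {W} f ((v , v≉0) , simple) =
      (to.⟦ v ⟧ , λ e → v≉0 (V.≈ᴹ-trans (V.≈ᴹ-sym (from∘to v))
        (V.≈ᴹ-trans (from.⟦⟧-cong e) (hom-0 from)))) ,
      λ S → transfer S (simple (preimage S))
      where
      open _≅_ f
      module to = Hom to
      module from = Hom from
      module V = Rep V
      module W = Rep W
      preimage : Subrep W → Subrep V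
      preimage S = record
        { Memᵥ = λ v → to.⟦ v ⟧ ∈ S.Memᵥ
        ; respᵥ = λ e → S.respᵥ (to.⟦⟧-cong e)
        ; 0∈ = S.respᵥ (W.≈ᴹ-sym (hom-0 to)) S.0∈
        ; +∈ = λ p q → S.respᵥ (W.≈ᴹ-sym (to.homo-+ _ _)) (S.+∈ p q)
        ; *∈ = λ c p → S.respᵥ (W.≈ᴹ-sym (to.homo-* c _)) (S.*∈ c p)
        ; ▷∈ = λ x p → S.respᵥ (W.≈ᴹ-sym (to.homo-▷ x _)) (S.▷∈ x p) }
        where module S = Subrep S
      transfer : ∀ S → _ → _
      transfer S (inj₁ zero) = inj₁ λ {w} w∈ → W.≈ᴹ-trans (W.≈ᴹ-sym (to∘from w))
        (W.≈ᴹ-trans (to.⟦⟧-cong (zero (Subrep.respᵥ S (W.≈ᴹ-sym (to∘from w)) w∈))) (hom-0 to))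
      transfer S (inj₂ all) = inj₂ λ w → Subrep.respᵥ S (to∘from w) (all from.⟦ w ⟧)

    ≅-injective : {V W : Rep J} (f : V ≅ W) (v v′ : Carrierᴹ V) →
                  _≈ᴹ_ W (Hom.⟦_⟧ (_≅_.to f) v) (Hom.⟦_⟧ (_≅_.to f) v′) → _≈ᴹ_ V v v′
    ≅-injective {V} f v v′ e =
      ≈ᴹ-trans V (≈ᴹ-sym V (from∘to v)) (≈ᴹ-trans V (Hom.⟦⟧-cong from e) (from∘to v′))
      where open _≅_ f

  module _ {J K : Sub} (J⊆K : Mem J ⊆ Mem K) where

    Ind-map-≅ : {V W : Rep J} → V ≅ W → Ind {J} {K} J⊆K V ≅ Ind {J} {K} J⊆K W
    Ind-map-≅ {V} {W} f = mk≅
      (Ind-map {J} {K} J⊆K to) (Hom.⟦_⟧ from′) (λ {h} {h′} → Hom.⟦⟧-cong from′ {h} {h′})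
      (λ h x → to∘from _) (λ h x → from∘to _)
      where
      open _≅_ f
      from′ = Ind-map {J} {K} J⊆K from

  -- The inclusion may be any proof: restriction only alters membership proofs, which `▷-cong`
  -- ignores.
  restrict-self : ∀ {J : Sub} (J⊆J : Mem J ⊆ Mem J) (W : Rep J) → restrict {J} {J} J⊆J W ≅ W
  restrict-self J⊆J W = mk≅
    (record { ⟦_⟧ = id ; ⟦⟧-cong = id ; homo-+ = λ _ _ → W.≈ᴹ-refl ; homo-* = λ _ _ → W.≈ᴹ-refl
            ; homo-▷ = λ _ _ → W.▷-cong refl W.≈ᴹ-refl })
    id id (λ _ → W.≈ᴹ-refl) (λ _ → W.≈ᴹ-refl)
    where module W = Rep W

  ≅ₚ-refl : ∀ P → P ≅ₚ P
  ≅ₚ-refl P = (id , id) , ≅-sym (restrict-self {J P} id (V P))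

  ≅⇒≅ₚ : ∀ {J o o′} {V W : Rep J} → V ≅ W → pair J o V ≅ₚ pair J o′ W
  ≅⇒≅ₚ {J} {W = W} f = (id , id) , ≅-trans f (≅-sym (restrict-self {J} id W))

  ≅ₚ⇒≅ : ∀ {J o o′} {V W : Rep J} → pair J o V ≅ₚ pair J o′ W → V ≅ W
  ≅ₚ⇒≅ {J} {W = W} ((J⊆J , _) , f) = ≅-trans f (restrict-self {J} J⊆J W)

  -- Compactness modulo an open subgroup.

  -- The points of the union of the cosets Jy.
  Covered : Sub → List Carrier → Pred Carrier ℓ
  Covered J ys x = Any (λ y → x ∙ y ⁻¹ ∈ Mem J) ys

  -- A set of the cover that contains y contains all of Jy, being stable under left translation by
  -- J; so one set per coset is enough.
  Covered-compact : ∀ J ys → IsCompactMod J (Covered J ys)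
  Covered-compact J []       F o stable cover = [] , λ ()
  Covered-compact J (y ∷ ys) F o stable cover =
    let i , y∈ = cover (here (resp J (sym (inverseʳ y)) (ε∈ J)))
        is , p = Covered-compact J ys F o stable (λ a → cover (there a))
    in i ∷ is , λ { {x} (here q) → here (open-resp-≈ (o i) (//-rightDividesˡ y x) (stable i q y∈))
                  ; (there a) → there (p a) }

  -- For J open, the cosets Jy themselves form an open J-stable cover. Together with
  -- `Covered-compact` this lets supports be handled as finite unions of cosets.
  compact⇒Covered : ∀ {a} {S : Pred Carrier a} J → IsOpen (Mem J) → IsCompactMod J S →
                    ∃ λ ys → S ⊆ Covered J ys
  compact⇒Covered J J-open compact = compact
    (λ y x → x ∙ y ⁻¹ ∈ Mem J)
    (λ y → translateʳ-open J-open (y ⁻¹))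
    (λ y j∈ x∈ → resp J (sym (assoc _ _ _)) (∙∈ J j∈ x∈))
    (λ {x} _ → x , resp J (sym (inverseʳ x)) (ε∈ J))

  -- Each Jy lies in Ky, and left multiplication by K preserves Ky.
  Covered-mono : ∀ {J K} ys → Mem J ⊆ Mem K → ∀ {k x} → k ∈ Mem K →
                 Covered J ys (k ∙ x) → Covered K ys x
  Covered-mono {J} {K} ys J⊆K {k} {x} k∈ = Any.map λ p →
    resp K (trans (∙-congˡ (assoc _ _ _)) (\\-leftDividesʳ k _)) (∙∈ K (⁻¹∈ K k∈) (J⊆K p))

  -- Functions extended by zero

  module _ {J K : Sub} (J-open : IsOpen (Mem J)) (J⊆K : Mem J ⊆ Mem K) (V : Rep J) where
    private module V = Rep V

    -- The decision is an argument so that lemmas can split on it; `extendByZero` supplies the one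
    -- from excluded middle.
    extend : V.Carrierᴹ → (x : Carrier) → Dec (x ∈ Mem J) → V.Carrierᴹ
    extend v x (yes p) = (x , p) V.▷ v
    extend v x (no _)  = V.0ᴹ

    extend-yes : ∀ v {x} d (p : x ∈ Mem J) → extend v x d V.≈ᴹ (x , p) V.▷ v
    extend-yes v (yes _) p = V.▷-cong refl V.≈ᴹ-refl
    extend-yes v (no ¬p) p = contradiction p ¬p

    extend-no : ∀ v {x} d → ¬ (x ∈ Mem J) → extend v x d V.≈ᴹ V.0ᴹ
    extend-no v (yes p) ¬p = contradiction p ¬p
    extend-no v (no _)  ¬p = V.≈ᴹ-refl

    private
      -- The hypotheses make x and y lie in J simultaneously: `back` serves the case where both
      -- values are zero, `agree` the other one.
      compare : ∀ {v w x y} d e → (y ∈ Mem J → x ∈ Mem J) →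
                (∀ (p : x ∈ Mem J) → ∃ λ q → (x , p) V.▷ v V.≈ᴹ (y , q) V.▷ w) →
                extend v x d V.≈ᴹ extend w y e
      compare {w = w} (yes p) e _ agree =
        let q , eq = agree p in V.≈ᴹ-trans eq (V.≈ᴹ-sym (extend-yes w e q))
      compare {w = w} (no ¬p) e back _ = V.≈ᴹ-sym (extend-no w e (¬p ∘ back))

    extendByZero : V.Carrierᴹ → IndCarrier {J} {K} J⊆K V
    extendByZero v = record
      { fun = λ (x , _) → extend v x em
      ; fun-cong = λ e → compare em em (resp J (sym e)) λ p →
          resp J e p , V.▷-cong e V.≈ᴹ-refl
      ; equivariant = equiv
      -- For u in J, x and xu lie in J simultaneously; for u in U, moreover, u fixes v.
      ; stabilizer = let U , fix = V.smooth v in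
          (U ∩ₛ record { sub = J ; is-open = J-open }) , λ (x , _) (u , _) (u∈U , u∈J) →
            compare em em (λ x∈ → ∙∈ J x∈ u∈J) λ xu∈ →
              let x∈ = resp J (//-rightDividesʳ u x) (∙∈ J xu∈ (⁻¹∈ J u∈J)) in
              x∈ , V.≈ᴹ-trans (V.▷-cong refl V.≈ᴹ-refl)
                     (V.≈ᴹ-trans (V.▷-· (x , x∈) (u , u∈J) v)
                       (V.▷-cong refl (fix (u , u∈J) u∈U)))
      ; supported = Mem J ,
          -- A J-stable set that contains 1 contains J, so a single member of the cover suffices.
          (λ F o stable cover → let i , ε∈F = cover (ε∈ J) in
            i ∷ [] , λ {x} x∈ → here (open-resp-≈ (o i) (identityʳ x) (stable i x∈ ε∈F))) ,
          λ x → extend-no v em }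
      where
      equiv : ∀ j x → extend v (proj₁ j ∙ proj₁ x) em V.≈ᴹ j V.▷ extend v (proj₁ x) em
      equiv (j , j∈) (x , _) with em {P = x ∈ Mem J}
      ... | yes x∈ = V.≈ᴹ-trans (extend-yes v em (∙∈ J j∈ x∈)) (V.▷-· (j , j∈) (x , x∈) v)
      ... | no x∉ = V.≈ᴹ-trans
        (extend-no v em λ jx∈ → x∉ (resp J (\\-leftDividesʳ j x) (∙∈ J (⁻¹∈ J j∈) jx∈)))
        (V.≈ᴹ-sym (V.▷-0 _))

    extendByZero-ε : ∀ v → fun (extendByZero v) 1[ K ] V.≈ᴹ v
    extendByZero-ε v = V.≈ᴹ-trans (extend-yes v em (ε∈ J)) (V.▷-ε v)

    -- A subrepresentation S of V yields the subrepresentation of functions with values in S.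
    -- Extending vectors of V by zero and evaluating at 1 shows that S is zero, or everything, as
    -- soon as the latter is.
    Ind-reflects-Irreducible : Irreducible (Ind {J} {K} J⊆K V) → Irreducible V
    Ind-reflects-Irreducible ((f , f≉0) , simple) =
      -- If no value of f were nonzero, f would vanish.
      decidable-stable em (λ none → f≉0 λ x → decidable-stable em λ fx≉0 → none (fun f x , fx≉0)) ,
      λ S → conclude S (simple (values S))
      where
      values : Subrep V → Subrep (Ind {J} {K} J⊆K V)
      values S = record
        { Memᵥ = λ f → ∀ x → fun f x ∈ S.Memᵥ
        ; respᵥ = λ e p x → S.respᵥ (e x) (p x)
        ; 0∈ = λ _ → S.0∈
        ; +∈ = λ p q x → S.+∈ (p x) (q x)
        ; *∈ = λ c p x → S.*∈ c (p x)
        ; ▷∈ = λ _ p x → p _ }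
        where module S = Subrep S
      extend∈ : ∀ S {v} → v ∈ Subrep.Memᵥ S → ∀ x d → extend v x d ∈ Subrep.Memᵥ S
      extend∈ S v∈ x (yes p) = Subrep.▷∈ S (x , p) v∈
      extend∈ S v∈ x (no _)  = Subrep.0∈ S
      conclude : ∀ S → _ → _
      conclude S (inj₁ zero) = inj₁ λ {v} v∈ → V.≈ᴹ-trans (V.≈ᴹ-sym (extendByZero-ε v))
        (zero {extendByZero v} (λ (x , _) → extend∈ S v∈ x em) 1[ K ])
      conclude S (inj₂ all) = inj₂ λ v → Subrep.respᵥ S (extendByZero-ε v) (all (extendByZero v) 1[ K ])

  -- A homomorphism is recovered from the induced one: apply it to the extension of v by zero and
  -- evaluate at 1.
  Ind-map-injective : ∀ {J K : Sub} → IsOpen (Mem J) → (J⊆K : Mem J ⊆ Mem K) {V W : Rep J} →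
    Injective (_≈ₕ_ {V = V} {W}) (_≈ₕ_ {V = Ind {J} {K} J⊆K V} {Ind {J} {K} J⊆K W})
              (Ind-map {J} {K} J⊆K {V} {W})
  Ind-map-injective {J} {K} o J⊆K {V} {W} {φ} {ψ} eq v = W.≈ᴹ-trans
    (Hom.⟦⟧-cong φ (≈ᴹ-sym V (extendByZero-ε {J} {K} o J⊆K V v)))
    (W.≈ᴹ-trans (eq (extendByZero {J} {K} o J⊆K V v) 1[ K ]) (Hom.⟦⟧-cong ψ (extendByZero-ε {J} {K} o J⊆K V v)))
    where module W = Rep W

  -- Changing the group on which induced functions live.

  module _ {J K₁ K : Sub} (J⊆K₁ : Mem J ⊆ Mem K₁) (J⊆K : Mem J ⊆ Mem K) (K₁⊆K : Mem K₁ ⊆ Mem K)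
           (V : Rep J) where
    private module V = Rep V

    -- Serves both to pass to a smaller group and to pass between two subgroups with the same
    -- elements.
    restrictFun : IndCarrier {J} {K} J⊆K V → IndCarrier {J} {K₁} J⊆K₁ V
    restrictFun f = record
      { fun = λ (x , p) → fun f (x , K₁⊆K p)
      ; fun-cong = fun-cong f
      ; equivariant = λ j (x , p) →
          V.≈ᴹ-trans (fun-cong f refl) (equivariant f j (x , K₁⊆K p))
      ; stabilizer = let U , fix = stabilizer f in U , λ (x , p) (u , q) u∈ →
          V.≈ᴹ-trans (fun-cong f refl) (fix (x , K₁⊆K p) (u , K₁⊆K q) u∈)
      ; supported = let S , compact , off = supported f in S , compact , λ _ → off _ }

  module _ (Q : Pair) {K : Sub} (K≐N : Mem K ≐ Mem (normalizer (J Q))) where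

    ⊆-≐normalizer : Mem (J Q) ⊆ Mem K
    ⊆-≐normalizer x∈ = proj₂ K≐N (⊆-normalizer (J Q) x∈)

    -- A pair in `normalized 𝔛` has the normalizer of J as its subgroup only up to `_≐_`. Inducing
    -- to K itself replaces the restriction in `_≅ₚ_` by an induced representation.
    normalizePair-≅ₚ : (K-open : IsOpen (Mem K)) →
      R.normalizePair G C Q ≅ₚ pair K K-open (Ind {J Q} {K} ⊆-≐normalizer (V Q))
    normalizePair-≅ₚ K-open = (proj₂ K≐N , proj₁ K≐N) , mk≅
      (record
        { ⟦_⟧ = restrictFun {J Q} {K} {N} ⊆-≐normalizer J⊆N (proj₁ K≐N) (V Q)
        ; ⟦⟧-cong = λ p _ → p _
        ; homo-+ = λ _ _ _ → W.≈ᴹ-refl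
        ; homo-* = λ _ _ _ → W.≈ᴹ-refl
        ; homo-▷ = λ _ f _ → fun-cong f refl })
      (restrictFun {J Q} {N} {K} J⊆N ⊆-≐normalizer (proj₂ K≐N) (V Q))
      (λ p _ → p _)
      (λ f _ → fun-cong f refl)
      (λ f _ → fun-cong f refl)
      where
      module W = Rep (V Q)
      N = normalizer (J Q)
      J⊆N = ⊆-normalizer (J Q)

  -- Transitivity of compact induction

  module _ {J K : Sub} (J-open : IsOpen (Mem J)) (K-open : IsOpen (Mem K))
           (J⊆K : Mem J ⊆ Mem K) (V : Rep J) where
    private
      module V = Rep V
      IndK = Ind {J} {K} J⊆K V
      Iterated = Ind {K} {whole} (λ _ → tt) IndK
      Direct = Ind {J} {whole} (λ _ → tt) V

    flatten : Carrierᴹ Iterated → Carrierᴹ Direct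
    flatten f = record
      { fun = λ x → fun (fun f x) 1[ K ]
      ; fun-cong = λ e → fun-cong f e 1[ K ]
      -- K acts by right translation, so f(jx)(1) = f(x)(1j) = f(x)(j1) = j f(x)(1).
      ; equivariant = λ (j , j∈) x → V.≈ᴹ-trans (equivariant f (j , J⊆K j∈) x 1[ K ])
          (V.≈ᴹ-trans (fun-cong (fun f x) (trans (identityˡ j) (sym (identityʳ j))))
            (equivariant (fun f x) (j , j∈) 1[ K ]))
      ; stabilizer = let U , fix = stabilizer f in U , λ x u u∈ → fix x u u∈ 1[ K ]
      ; supported = Covered J cosets , Covered-compact J cosets , λ (x , _) → vanish x em }
      where
      S = proj₁ (supported f)
      outer : ∃ λ ys → S ⊆ Covered K ys
      outer = compact⇒Covered K K-open (proj₁ (proj₂ (supported f)))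
      inner : ∀ y → ∃ λ zs → proj₁ (supported (fun f (y , tt))) ⊆ Covered J zs
      inner y = compact⇒Covered J J-open (proj₁ (proj₂ (supported (fun f (y , tt)))))
      -- f(x)(1) = f(y)(k) for x = ky, so the supports of the f(y) translated by y
      -- suffice, y ranging over representatives of the support of f modulo K.
      cosets : List Carrier
      cosets = concatMap (λ y → map (_∙ y) (proj₁ (inner y))) (proj₁ outer)
      vanish : ∀ x → Dec (Covered K (proj₁ outer) x) → ¬ Covered J cosets x →
               fun (fun f (x , tt)) 1[ K ] V.≈ᴹ V.0ᴹ
      vanish x (no uncovered) _ =
        proj₂ (proj₂ (supported f)) (x , tt) (uncovered ∘ proj₂ outer) 1[ K ]
      vanish x (yes covered) uncovered with find covered
      ... | y , y∈ , k∈ = V.≈ᴹ-trans (fun-cong f (sym (//-rightDividesˡ y x)) 1[ K ])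
        (V.≈ᴹ-trans (equivariant f (x ∙ y ⁻¹ , k∈) (y , tt) 1[ K ])
        (V.≈ᴹ-trans (fun-cong (fun f (y , tt)) (identityˡ _))
          (proj₂ (proj₂ (supported (fun f (y , tt)))) (x ∙ y ⁻¹ , k∈) λ s →
            uncovered (concatMap⁺ (λ y → map (_∙ y) (proj₁ (inner y)))
              (lose y∈ (map⁺ (Any.map (λ {z} → resp J (reassociate z)) (proj₂ (inner y) s))))))))
        where
        reassociate : ∀ z → x ∙ y ⁻¹ ∙ z ⁻¹ ≈ x ∙ (z ∙ y) ⁻¹
        reassociate z = trans (assoc _ _ _) (∙-congˡ (sym (⁻¹-anti-homo-∙ z y)))

    unflatten : Carrierᴹ Direct → Carrierᴹ Iterated
    unflatten h = record
      { fun = λ x → restrictFun {J} {K} {whole} J⊆K (λ _ → tt) (λ _ → tt) V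
                      (_▷_ Direct x h)
      ; fun-cong = λ e _ → fun-cong h (∙-congˡ e)
      ; equivariant = λ _ _ _ → fun-cong h (sym (assoc _ _ _))
      ; stabilizer = let U , fix = stabilizer h in U , λ x u u∈ (k , _) →
          V.≈ᴹ-trans (fun-cong h (sym (assoc _ _ _))) (fix (k ∙ proj₁ x , tt) u u∈)
      -- If h(kx) is nonzero, then kx lies in one of finitely many Jy, whence x lies in Ky.
      ; supported =
          let S , compact , off = supported h
              ys , S⊆ = compact⇒Covered J J-open compact
          in Covered K ys , Covered-compact K ys , λ (x , _) uncovered (k , k∈) →
               off (k ∙ x , tt) λ s → uncovered (Covered-mono {J} {K} ys J⊆K k∈ (S⊆ s)) }

    -- Equivariance under K gives f(x)(k) = f(kx)(1), so the values at 1 kept by `flatten` determine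
    -- f.
    Ind-transitive : Iterated ≅ Direct
    Ind-transitive = mk≅
      (record
        { ⟦_⟧ = flatten
        ; ⟦⟧-cong = λ p x → p x 1[ K ]
        ; homo-+ = λ _ _ _ → V.≈ᴹ-refl
        ; homo-* = λ _ _ _ → V.≈ᴹ-refl
        ; homo-▷ = λ _ _ _ → V.≈ᴹ-refl })
      unflatten
      (λ p x k → p _)
      (λ h x → fun-cong h (identityˡ _))
      (λ f (x , _) k → V.≈ᴹ-trans (equivariant f k (x , tt) 1[ K ])
        (fun-cong (fun f (x , tt)) (identityˡ _)))

  -- Conjugation

  conjugate-cancelʳ : ∀ g x → conjugate g (conjugate (g ⁻¹) x) ≈ x
  conjugate-cancelʳ g x = trans (sym (conjugate-comp g (g ⁻¹) x))
    (trans (conjugate-cong (inverseʳ g) refl) (conjugate-id x))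

  conjugate-cancelˡ : ∀ g x → conjugate (g ⁻¹) (conjugate g x) ≈ x
  conjugate-cancelˡ g x = trans (sym (conjugate-comp (g ⁻¹) g x))
    (trans (conjugate-cong (inverseˡ g) refl) (conjugate-id x))

  conjugate-conjugate : ∀ a b x → conjugate a (conjugate b x) ≈ conjugate (conjugate a b) (conjugate a x)
  conjugate-conjugate a b x = trans (conjugate-∙ a (b ∙ x) (b ⁻¹))
    (∙-cong (conjugate-∙ a b x) (conjugate-⁻¹ a b))

  -- With n = g⁻¹xg, `swap` says that g⁻¹(x⁻¹yx)g = n⁻¹(g⁻¹yg)n. Hence x normalizes J₁ exactly when
  -- n normalizes J.
  conjSub-normalizer : ∀ g {J J₁ : Sub} → Mem (conjSub g J) ≐ Mem J₁ →
                       Mem (conjSub g (normalizer J)) ≐ Mem (normalizer J₁)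
  conjSub-normalizer g {J} {J₁} (gJ⊆J₁ , J₁⊆gJ) =
    (λ {x} (p , q) →
      (λ {y} a → gJ⊆J₁ (p (resp J (swap x y) (J₁⊆gJ a)))) ,
      (λ {y} a → gJ⊆J₁ (resp J (sym (swap x y)) (q (J₁⊆gJ a))))) ,
    -- Here z is an arbitrary element of G, so `swap` is applied at y = gzg⁻¹.
    (λ {x} (p , q) →
      (λ {z} a → resp J (conjugate-cancelˡ g z) (J₁⊆gJ (p (gJ⊆J₁
        (resp J (trans (conjugate-cong refl (sym (conjugate-cancelˡ g z))) (sym (swap x (conjugate g z)))) a))))) ,
      (λ {z} a → resp J (trans (swap x (conjugate g z)) (conjugate-cong refl (conjugate-cancelˡ g z)))
        (J₁⊆gJ (q (gJ⊆J₁ (resp J (sym (conjugate-cancelˡ g z)) a))))))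
    where
    swap : ∀ x y → conjugate (g ⁻¹) (conjugate (x ⁻¹) y) ≈
                   conjugate (conjugate (g ⁻¹) x ⁻¹) (conjugate (g ⁻¹) y)
    swap x y = trans (conjugate-conjugate (g ⁻¹) (x ⁻¹) y)
      (conjugate-cong (conjugate-⁻¹ (g ⁻¹) x) refl)

  module _ (h : Carrier) {J K J₁ K₁ : Sub} (J-open : IsOpen (Mem J))
           (J⊆K : Mem J ⊆ Mem K) (J₁⊆K₁ : Mem J₁ ⊆ Mem K₁) (V : Rep J) (V₁ : Rep J₁)
           (toK : ∀ {x} → x ∈ Mem K₁ → conjugate h x ∈ Mem K)
           (toJ : ∀ {x} → x ∈ Mem J₁ → conjugate h x ∈ Mem J)
           (fromJ : ∀ {x} → conjugate h x ∈ Mem J → x ∈ Mem J₁) where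
    private
      module V = Rep V
      module V₁ = Rep V₁

    -- V and V₁ are representations of different groups, so `α` is a bare map with the conditions
    -- needed, not a `Hom`. Taking h = g⁻¹ and h = g gives the two directions of
    -- `conj-normalizePair`.
    conjugateFun : (α : V.Carrierᴹ → V₁.Carrierᴹ) →
                   (∀ {v w} → v V.≈ᴹ w → α v V₁.≈ᴹ α w) →
                   (∀ {x} (p : x ∈ Mem J₁) v → α ((conjugate h x , toJ p) V.▷ v) V₁.≈ᴹ (x , p) V₁.▷ α v) →
                   α V.0ᴹ V₁.≈ᴹ V₁.0ᴹ →
                   IndCarrier {J} {K} J⊆K V → IndCarrier {J₁} {K₁} J₁⊆K₁ V₁
    conjugateFun α α-cong α-▷ α-0 f = record
      { fun = λ (x , p) → α (fun f (conjugate h x , toK p))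
      ; fun-cong = λ e → α-cong (fun-cong f (conjugate-cong refl e))
      ; equivariant = λ (j , j∈) (x , x∈) → V₁.≈ᴹ-trans
          (α-cong (V.≈ᴹ-trans (fun-cong f (conjugate-∙ h j x))
            (equivariant f (conjugate h j , toJ j∈) (conjugate h x , toK x∈))))
          (α-▷ j∈ _)
      ; stabilizer = let U , fix = stabilizer f in conjOpen (h ⁻¹) U , λ (x , x∈) (u , u∈) a →
          α-cong (V.≈ᴹ-trans (fun-cong f (conjugate-∙ h x u))
            (fix (conjugate h x , toK x∈) (conjugate h u , toK u∈)
              (OpenSubgroup.resp U (conjugate-cong (⁻¹-involutive h) refl) a)))
      -- If hxh⁻¹ lies in Jy, then x lies in J₁z for z = h⁻¹yh.
      ; supported =
          let S , compact , off = supported f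
              ys , S⊆ = compact⇒Covered J J-open compact
              zs = map (conjugate (h ⁻¹)) ys
          in Covered J₁ zs , Covered-compact J₁ zs , λ (x , x∈) uncovered →
               V₁.≈ᴹ-trans (α-cong (off (conjugate h x , toK x∈) λ s → uncovered
                 (map⁺ (Any.map (λ {y} p → fromJ (resp J (shift x y) p)) (S⊆ s))))) α-0 }
      where
      shift : ∀ x y → conjugate h x ∙ y ⁻¹ ≈ conjugate h (x ∙ conjugate (h ⁻¹) y ⁻¹)
      shift x y = sym (trans (conjugate-∙ h x _) (∙-congˡ
        (trans (conjugate-⁻¹ h _) (⁻¹-cong (conjugate-cancelʳ h y)))))

  -- Compose f with x ↦ g⁻¹xg and follow it by the given isomorphism from the conjugate of `V P` to
  -- `V Q`; the inverse uses gxg⁻¹ and the inverse isomorphism.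
  conj-normalizePair : ∀ g {P Q} → R.conjPair G C g P ≅ₚ Q → R.conjPair G C g (R.normalizePair G C P) ≅ₚ R.normalizePair G C Q
  conj-normalizePair g {P} {Q} ((gJ⊆J₁ , J₁⊆gJ) , a) = gN≐N₁ , mk≅
    (record
      { ⟦_⟧ = conjugateFun (g ⁻¹) {J P} {N} {J Q} {N₁} (J-open P) J⊆N J₁⊆N₁ (V P) (V Q)
          (proj₂ gN≐N₁) J₁⊆gJ gJ⊆J₁ to.⟦_⟧ to.⟦⟧-cong
          (λ {x} p v → W.≈ᴹ-trans (to.homo-▷ (x , J₁⊆gJ p) v) (W.▷-cong refl W.≈ᴹ-refl))
          (hom-0 to)
      ; ⟦⟧-cong = λ p _ → to.⟦⟧-cong (p _)
      ; homo-+ = λ _ _ _ → to.homo-+ _ _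
      ; homo-* = λ _ _ _ → to.homo-* _ _
      ; homo-▷ = λ _ f _ → to.⟦⟧-cong (fun-cong f (sym (conjugate-∙ (g ⁻¹) _ _))) })
    (conjugateFun g {J Q} {N₁} {J P} {N} (J-open Q) J₁⊆N₁ J⊆N (V Q) (V P)
      (λ {x} p → proj₁ gN≐N₁ (resp N (sym (conjugate-cancelˡ g x)) p))
      toJ₁
      (λ {x} p → resp (J P) (conjugate-cancelˡ g x) (J₁⊆gJ p))
      from.⟦_⟧ from.⟦⟧-cong
      (λ {x} p v → VP.≈ᴹ-trans (from.⟦⟧-cong (W.▷-cong refl W.≈ᴹ-refl))
        (VP.≈ᴹ-trans (from.homo-▷ (conjugate g x , J₁⊆gJ (toJ₁ p)) v)
          (VP.▷-cong (conjugate-cancelˡ g x) VP.≈ᴹ-refl)))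
      (hom-0 from))
    (λ p _ → from.⟦⟧-cong (p _))
    (λ f (x , _) → W.≈ᴹ-trans (to∘from _) (fun-cong f (conjugate-cancelʳ g x)))
    (λ f (x , _) → VP.≈ᴹ-trans (from∘to _) (fun-cong f (conjugate-cancelˡ g x)))
    where
    open _≅_ a
    module to = Hom to
    module from = Hom from
    module VP = Rep (V P)
    module W = Rep (V Q)
    N = normalizer (J P)
    N₁ = normalizer (J Q)
    J⊆N = ⊆-normalizer (J P)
    J₁⊆N₁ = ⊆-normalizer (J Q)
    gN≐N₁ : Mem (conjSub g N) ≐ Mem N₁
    gN≐N₁ = conjSub-normalizer g {J P} {J Q} (gJ⊆J₁ , J₁⊆gJ)
    toJ₁ : ∀ {x} → x ∈ Mem (J P) → conjugate g x ∈ Mem (J Q)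
    toJ₁ {x} p = gJ⊆J₁ (resp (J P) (sym (conjugate-cancelˡ g x)) p)

  conjPair-cong : ∀ g {P Q} → P ≅ₚ Q → R.conjPair G C g P ≅ₚ R.conjPair G C g Q
  conjPair-cong g {P} {Q} ((P⊆Q , Q⊆P) , a) = ((λ p → P⊆Q p) , (λ q → Q⊆P q)) , mk≅
    (record { ⟦_⟧ = to.⟦_⟧ ; ⟦⟧-cong = to.⟦⟧-cong ; homo-+ = to.homo-+ ; homo-* = to.homo-*
            ; homo-▷ = λ _ → to.homo-▷ _ })
    (Hom.⟦_⟧ from) (Hom.⟦⟧-cong from) to∘from from∘to
    where
    open _≅_ a
    module to = Hom to

  -- The action of g itself is the isomorphism, since g(g⁻¹xg)v = x(gv).
  conjPair-inner : ∀ P {g} → g ∈ Mem (J P) → R.conjPair G C g P ≅ₚ P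
  conjPair-inner P {g} g∈ = ⊆-normalizer (J P) g∈ , mk≅
    (record
      { ⟦_⟧ = (g , g∈) W.▷_
      ; ⟦⟧-cong = W.▷-cong refl
      ; homo-+ = W.▷-+ _
      ; homo-* = W.▷-* _
      ; homo-▷ = λ (x , x∈) v → W.≈ᴹ-trans (W.≈ᴹ-sym (W.▷-· _ _ v))
          (W.≈ᴹ-trans (W.▷-cong (move x) W.≈ᴹ-refl) (W.▷-· _ _ v)) })
    ((g ⁻¹ , ⁻¹∈ (J P) g∈) W.▷_)
    (W.▷-cong refl)
    (λ v → W.≈ᴹ-trans (W.≈ᴹ-sym (W.▷-· _ _ v)) (W.≈ᴹ-trans (W.▷-cong (inverseʳ g) W.≈ᴹ-refl) (W.▷-ε v)))
    (λ v → W.≈ᴹ-trans (W.≈ᴹ-sym (W.▷-· _ _ v)) (W.≈ᴹ-trans (W.▷-cong (inverseˡ g) W.≈ᴹ-refl) (W.▷-ε v)))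
    where
    module W = Rep (V P)
    move : ∀ x → g ∙ conjugate (g ⁻¹) x ≈ x ∙ g
    move x = trans (∙-congˡ (assoc _ _ _))
      (trans (\\-leftDividesˡ g _) (∙-congˡ (⁻¹-involutive g)))

  -- Twisting by automorphisms of C

  module _ (τ : Automorphism C) where
    private module τ = Automorphism τ

    -- Restriction of scalars along τ. For τ = σ⁻¹ it is a model of σ(V) on the space of V, free of
    -- tensors.
    scalars : ∀ {J : Sub} → Rep J → Rep J
    scalars V = record
      { space = record
        { Carrierᴹ = V.Carrierᴹ
        ; _≈ᴹ_ = V._≈ᴹ_
        ; _+ᴹ_ = V._+ᴹ_
        ; _*ₗ_ = λ c → τ.⟦ c ⟧ V.*ₗ_
        ; 0ᴹ = V.0ᴹ
        ; -ᴹ_ = V.-ᴹ_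
        ; isLeftModule = record
          { isLeftSemimodule = record
            { +ᴹ-isCommutativeMonoid = M.+ᴹ-isCommutativeMonoid
            ; isPreleftSemimodule = record
              { *ₗ-cong = λ p q → M.*ₗ-cong (τ.⟦⟧-cong p) q
              ; *ₗ-zeroˡ = λ v → M.≈ᴹ-trans (M.*ₗ-cong τ.0#-homo M.≈ᴹ-refl) (M.*ₗ-zeroˡ v)
              ; *ₗ-distribʳ = λ v c d → M.≈ᴹ-trans (M.*ₗ-cong (τ.+-homo c d) M.≈ᴹ-refl) (M.*ₗ-distribʳ v _ _)
              ; *ₗ-identityˡ = λ v → M.≈ᴹ-trans (M.*ₗ-cong τ.1#-homo M.≈ᴹ-refl) (M.*ₗ-identityˡ v)
              ; *ₗ-assoc = λ c d v → M.≈ᴹ-trans (M.*ₗ-cong (τ.*-homo c d) M.≈ᴹ-refl) (M.*ₗ-assoc _ _ v)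
              ; *ₗ-zeroʳ = λ c → M.*ₗ-zeroʳ _
              ; *ₗ-distribˡ = λ c → M.*ₗ-distribˡ _ } }
          ; -ᴹ‿cong = M.-ᴹ‿cong
          ; -ᴹ‿inverse = M.-ᴹ‿inverse } }
      ; _▷_ = V._▷_
      ; ▷-cong = V.▷-cong
      ; ▷-+ = V.▷-+
      ; ▷-* = λ x c → V.▷-* x _
      ; ▷-ε = V.▷-ε
      ; ▷-· = V.▷-·
      ; smooth = V.smooth }
      where
      module V = Rep V
      module M = LeftModule V.space

    scalars-≅ : ∀ {J : Sub} {V W : Rep J} → V ≅ W → scalars V ≅ scalars W
    scalars-≅ f = mk≅
      (record { ⟦_⟧ = to.⟦_⟧ ; ⟦⟧-cong = to.⟦⟧-cong ; homo-+ = to.homo-+ ; homo-* = λ _ → to.homo-* _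
              ; homo-▷ = to.homo-▷ })
      (Hom.⟦_⟧ from) (Hom.⟦⟧-cong from) to∘from from∘to
      where
      open _≅_ f
      module to = Hom to

    -- Both sides consist of the same functions; the records are rebuilt only because their types
    -- differ.
    scalars-Ind : ∀ {J K : Sub} (J⊆K : Mem J ⊆ Mem K) (V : Rep J) →
                  scalars (Ind {J} {K} J⊆K V) ≅ Ind {J} {K} J⊆K (scalars V)
    scalars-Ind {J} {K} J⊆K V = mk≅
      (record
        { ⟦_⟧ = λ f → record { fun = fun f ; fun-cong = fun-cong f ; equivariant = equivariant f
                             ; stabilizer = stabilizer f ; supported = supported f }
        ; ⟦⟧-cong = id
        ; homo-+ = λ _ _ _ → ≈ᴹ-refl V
        ; homo-* = λ _ _ _ → ≈ᴹ-refl V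
        ; homo-▷ = λ _ _ _ → ≈ᴹ-refl V })
      (λ f → record { fun = fun f ; fun-cong = fun-cong f ; equivariant = equivariant f
                    ; stabilizer = stabilizer f ; supported = supported f })
      id (λ _ _ → ≈ᴹ-refl V) (λ _ _ → ≈ᴹ-refl V)

  module _ (σ : Automorphism C) where
    private
      module σ = Automorphism σ
      τ = Group._⁻¹ (Aut C) σ
      module τ = Automorphism τ

      τσ : ∀ c → τ.⟦ σ.⟦ c ⟧ ⟧ C.≈ c
      τσ = Group.inverseˡ (Aut C) σ

      στ : ∀ c → σ.⟦ τ.⟦ c ⟧ ⟧ C.≈ c
      στ = Group.inverseʳ (Aut C) σ

    module _ {J : Sub} (V : Rep J) where
      private
        module V = Rep V
        module M = LeftModule V.space
        module MP = GroupProperties M.+ᴹ-group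
        module T = LeftModule (space (twist σ V))
        module TP = GroupProperties T.+ᴹ-group

      untwist : Tensor σ V → V.Carrierᴹ
      untwist (c ⊗ v) = τ.⟦ c ⟧ V.*ₗ v
      untwist (s ⊕ t) = untwist s V.+ᴹ untwist t
      untwist 𝟘       = V.0ᴹ
      untwist (⊖ s)   = V.-ᴹ untwist s

      untwist-cong : ∀ {s t} → s T.≈ᴹ t → untwist s V.≈ᴹ untwist t
      untwist-cong ∼-refl = M.≈ᴹ-refl
      untwist-cong (∼-sym p) = M.≈ᴹ-sym (untwist-cong p)
      untwist-cong (∼-trans p q) = M.≈ᴹ-trans (untwist-cong p) (untwist-cong q)
      untwist-cong (⊗-cong p q) = M.*ₗ-cong (τ.⟦⟧-cong p) q
      untwist-cong (⊕-cong p q) = M.+ᴹ-cong (untwist-cong p) (untwist-cong q)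
      untwist-cong (⊖-cong p) = M.-ᴹ‿cong (untwist-cong p)
      untwist-cong (⊕-assoc s t u) = M.+ᴹ-assoc _ _ _
      untwist-cong (⊕-comm s t) = M.+ᴹ-comm _ _
      untwist-cong (⊕-identityˡ s) = M.+ᴹ-identityˡ _
      untwist-cong (⊖-inverseˡ s) = M.-ᴹ‿inverseˡ _
      untwist-cong (⊗-addˡ c d v) =
        M.≈ᴹ-trans (M.*ₗ-cong (τ.+-homo c d) M.≈ᴹ-refl) (M.*ₗ-distribʳ v _ _)
      untwist-cong (⊗-addʳ c v w) = M.*ₗ-distribˡ _ v w
      -- The relation is respected because σ⁻¹(cσ(a)) = σ⁻¹(c)a.
      untwist-cong (⊗-balanced c a v) = M.≈ᴹ-trans
        (M.*ₗ-cong (C.trans (τ.*-homo c _) (C.*-congˡ (τσ a))) M.≈ᴹ-refl) (M.*ₗ-assoc _ a v)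

      untwist-scale : ∀ c s → untwist (c T.*ₗ s) V.≈ᴹ τ.⟦ c ⟧ V.*ₗ untwist s
      untwist-scale c (d ⊗ v) = M.≈ᴹ-trans (M.*ₗ-cong (τ.*-homo c d) M.≈ᴹ-refl) (M.*ₗ-assoc _ _ v)
      untwist-scale c (s ⊕ t) = M.≈ᴹ-trans
        (M.+ᴹ-cong (untwist-scale c s) (untwist-scale c t)) (M.≈ᴹ-sym (M.*ₗ-distribˡ _ _ _))
      untwist-scale c 𝟘       = M.≈ᴹ-sym (M.*ₗ-zeroʳ _)
      untwist-scale c (⊖ s)   = M.≈ᴹ-trans (M.-ᴹ‿cong (untwist-scale c s))
        (M.≈ᴹ-sym (MP.inverseˡ-unique _ _ (M.≈ᴹ-trans (M.≈ᴹ-sym (M.*ₗ-distribˡ _ _ _))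
          (M.≈ᴹ-trans (M.*ₗ-cong C.refl (M.-ᴹ‿inverseˡ _)) (M.*ₗ-zeroʳ _)))))

      untwist-▷ : ∀ x s → untwist (_▷_ (twist σ V) x s) V.≈ᴹ x V.▷ untwist s
      untwist-▷ x (c ⊗ v) = M.≈ᴹ-sym (V.▷-* x _ v)
      untwist-▷ x (s ⊕ t) = M.≈ᴹ-trans (M.+ᴹ-cong (untwist-▷ x s) (untwist-▷ x t)) (M.≈ᴹ-sym (V.▷-+ x _ _))
      untwist-▷ x 𝟘       = M.≈ᴹ-sym (V.▷-0 x)
      untwist-▷ x (⊖ s)   = M.≈ᴹ-trans (M.-ᴹ‿cong (untwist-▷ x s)) (M.≈ᴹ-sym (V.▷-neg x _))

      1⊗0 : (C.1# ⊗ V.0ᴹ) T.≈ᴹ 𝟘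
      1⊗0 = TP.identityʳ-unique _ _ (∼-trans (∼-sym (⊗-addʳ _ _ _)) (⊗-cong C.refl (M.+ᴹ-identityˡ _)))

      1⊗untwist : ∀ s → (C.1# ⊗ untwist s) T.≈ᴹ s
      -- Balancing moves σ⁻¹(c) back across the tensor sign, where it becomes c.
      1⊗untwist (c ⊗ v) = ∼-trans (∼-sym (⊗-balanced _ _ v))
        (⊗-cong (C.trans (C.*-identityˡ _) (στ c)) M.≈ᴹ-refl)
      1⊗untwist (s ⊕ t) = ∼-trans (⊗-addʳ _ _ _) (⊕-cong (1⊗untwist s) (1⊗untwist t))
      1⊗untwist 𝟘       = 1⊗0
      1⊗untwist (⊖ s)   = ∼-trans
        (TP.inverseˡ-unique _ _ (∼-trans (∼-sym (⊗-addʳ _ _ _))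
          (∼-trans (⊗-cong C.refl (M.-ᴹ‿inverseˡ _)) 1⊗0)))
        (⊖-cong (1⊗untwist s))

      -- c ⊗ v = 1 ⊗ σ⁻¹(c) v
      twist≅scalars : twist σ V ≅ scalars τ V
      twist≅scalars = mk≅
        (record
          { ⟦_⟧ = untwist
          ; ⟦⟧-cong = untwist-cong
          ; homo-+ = λ _ _ → M.≈ᴹ-refl
          ; homo-* = untwist-scale
          ; homo-▷ = untwist-▷ })
        (C.1# ⊗_) (⊗-cong C.refl)
        (λ v → M.≈ᴹ-trans (M.*ₗ-cong τ.1#-homo M.≈ᴹ-refl) (M.*ₗ-identityˡ v))
        1⊗untwist

    twist-≅ : ∀ {J : Sub} {V W : Rep J} → V ≅ W → twist σ V ≅ twist σ W
    twist-≅ {V = V} {W} f =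
      ≅-trans (twist≅scalars V) (≅-trans (scalars-≅ τ f) (≅-sym (twist≅scalars W)))

    -- Passing through `scalars` on both sides reduces the claim to an identity of functions.
    twist-Ind : ∀ {J K : Sub} (J⊆K : Mem J ⊆ Mem K) (V : Rep J) →
                twist σ (Ind {J} {K} J⊆K V) ≅ Ind {J} {K} J⊆K (twist σ V)
    twist-Ind {J} {K} J⊆K V = ≅-trans (twist≅scalars (Ind {J} {K} J⊆K V))
      (≅-trans (scalars-Ind τ {J} {K} J⊆K V) (Ind-map-≅ {J} {K} J⊆K (≅-sym (twist≅scalars V))))

  -- The elements of 𝔛′

  module _ (P Q : Pair) (e : P ≅ₚ R.normalizePair G C Q) where
    private module Q = Rep (V Q)

    normalized-V : V P ≅ Ind {J Q} {J P} (⊆-≐normalizer Q {J P} (proj₁ e)) (V Q)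
    normalized-V = ≅ₚ⇒≅ {o = J-open P} {J-open P}
      (≅ₚ-trans {P} {R.normalizePair G C Q}
        {pair (J P) (J-open P) (Ind {J Q} {J P} (⊆-≐normalizer Q {J P} (proj₁ e)) (V Q))}
        e (normalizePair-≅ₚ Q {J P} (proj₁ e) (J-open P)))

    ind-normalized : R.ind G C P ≅ R.ind G C Q
    ind-normalized = ≅-trans (Ind-map-≅ {J P} {whole} (λ _ → tt) normalized-V)
      (Ind-transitive (J-open Q) (J-open P) (⊆-≐normalizer Q {J P} (proj₁ e)) (V Q))

    -- Twisting leaves J and its normalizer alone and commutes with the induction that defines V′.
    twist-normalized : ∀ σ → R.twistPair G C σ P ≅ₚ R.normalizePair G C (R.twistPair G C σ Q)
    twist-normalized σ = ≅ₚ-trans {R.twistPair G C σ P} {IndP} {R.normalizePair G C (R.twistPair G C σ Q)}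
      (≅⇒≅ₚ {o = J-open P} {J-open P}
        (≅-trans (twist-≅ σ normalized-V)
          (twist-Ind σ {J Q} {J P} (⊆-≐normalizer Q {J P} (proj₁ e)) (V Q))))
      (≅ₚ-sym {R.normalizePair G C (R.twistPair G C σ Q)} {IndP}
        (normalizePair-≅ₚ (R.twistPair G C σ Q) {J P} (proj₁ e) (J-open P)))
      where
      IndP : Pair
      IndP = pair (J P) (J-open P) (Ind {J Q} {J P} (⊆-≐normalizer Q {J P} (proj₁ e)) (twist σ (V Q)))

    CType-normalized : IsCType Q → IsCType P
    CType-normalized (_ , ind-irreducible) =
      Ind-reflects-Irreducible {J P} {whole} (J-open P) (λ _ → tt) (V P) ind-P , ind-P
      where
      ind-P : Irreducible (R.ind G C P)
      ind-P = Irreducible-resp-≅ (≅-sym ind-normalized) ind-irreducible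

    -- ψ ∈ End(ind P) ≅ End(ind Q) comes from some φ ∈ End(V Q), hence from the
    -- endomorphism of V P induced by φ.
    normalized-surjective :
      Surjective (_≈ₕ_ {V = V Q} {V Q}) (_≈ₕ_ {V = R.ind G C Q} {R.ind G C Q})
                 (Ind-map {J Q} {whole} (λ _ → tt) {V Q} {V Q}) →
      Surjective (_≈ₕ_ {V = V P} {V P}) (_≈ₕ_ {V = R.ind G C P} {R.ind G C P})
                 (Ind-map {J P} {whole} (λ _ → tt) {V P} {V P})
    normalized-surjective surjective ψ = Hom-comp a.from (Hom-comp φ′ a.to) , λ {θ} θ≈ f →
      -- `ind-normalized` sends f to x ↦ a(f(x))(1), so both sides are compared as functions with
      -- values in `V Q`.
      ≅-injective ind-normalized (Hom.⟦_⟧ (Ind-map {J P} {whole} (λ _ → tt) {V P} {V P} θ) f) (ψ.⟦ f ⟧) λ x →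
        Q.≈ᴹ-trans (a.to.⟦⟧-cong (θ≈ (fun f x)) 1[ J P ])
        (Q.≈ᴹ-trans (a.to∘from (φ′.⟦ a.to.⟦ fun f x ⟧ ⟧) 1[ J P ])
        -- `φ′` applies `φ` to values, and `φ` was chosen to induce the transport of `ψ` to ind Q.
        (Q.≈ᴹ-trans (proj₂ preimage {φ} (λ _ → Q.≈ᴹ-refl) T.to.⟦ f ⟧ x)
          (T.to.⟦⟧-cong {ψ.⟦ T.from.⟦ T.to.⟦ f ⟧ ⟧ ⟧} {ψ.⟦ f ⟧}
            (ψ.⟦⟧-cong {T.from.⟦ T.to.⟦ f ⟧ ⟧} {f} (T.from∘to f)) x)))
      where
      module a where
        open _≅_ normalized-V public
        module to = Hom to
      module T where
        open _≅_ ind-normalized public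
        module to = Hom to
        module from = Hom from
      module ψ = Hom ψ
      preimage = surjective (Hom-comp T.to (Hom-comp ψ T.from))
      φ : Hom (V Q) (V Q)
      φ = proj₁ preimage
      φ′ = Ind-map {J Q} {J P} (⊆-≐normalizer Q {J P} (proj₁ e)) φ
      module φ′ = Hom φ′

    normalized-twist-invariant : ∀ σ g → R.conjPair G C g Q ≅ₚ R.twistPair G C σ Q →
                                 V P ≅ R.twist G C σ (V P)
    normalized-twist-invariant σ g c = ≅ₚ⇒≅ {o = J-open P} {J-open P}
      (≅ₚ-trans {P} {R.normalizePair G C Q} {R.twistPair G C σ P} e
        (≅ₚ-trans {R.normalizePair G C Q} {R.conjPair G C g (R.normalizePair G C Q)} {R.twistPair G C σ P}
          (≅ₚ-sym {R.conjPair G C g (R.normalizePair G C Q)} {R.normalizePair G C Q}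
            -- Twisting keeps J, so the first component of `c` says gJg⁻¹ = J: it is a proof that g
            -- lies in the normalizer.
            (conjPair-inner (R.normalizePair G C Q) (proj₁ c)))
          (≅ₚ-trans {R.conjPair G C g (R.normalizePair G C Q)}
            {R.normalizePair G C (R.twistPair G C σ Q)} {R.twistPair G C σ P}
            (conj-normalizePair g {Q} {R.twistPair G C σ Q} c)
            (≅ₚ-sym {R.twistPair G C σ P} {R.normalizePair G C (R.twistPair G C σ Q)} (twist-normalized σ)))))

  module _ (P Q : Pair) (e : P ≅ₚ R.normalizePair G C Q) (σ : Automorphism C) where

    -- Carries the hypothesis of H-unicity from V′ down to V, where unicity for `𝔛` can be applied.
    ind-untwist : R.ind G C P ≅ R.ind G C (R.twistPair G C σ P) →
                  R.ind G C Q ≅ R.ind G C (R.twistPair G C σ Q)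
    ind-untwist f = ≅-trans (≅-sym (ind-normalized P Q e)) (≅-trans f
      (ind-normalized (R.twistPair G C σ P) (R.twistPair G C σ Q) (twist-normalized P Q e σ)))

  -- Passage of each property from `𝔛` to `normalized 𝔛`.

  module _ (𝔛 : PairSet) where

    CTypes-normalized : ConsistsOfCTypes 𝔛 → ConsistsOfCTypes (normalized 𝔛)
    CTypes-normalized ctypes {P} (Q , Q∈ , e) = CType-normalized P Q e (ctypes Q∈)

    Intertwining-normalized : Intertwining 𝔛 → Intertwining (normalized 𝔛)
    Intertwining-normalized intertwining {P} (Q , Q∈ , e) =
      (λ {φ} {ψ} → Ind-map-injective {J P} {whole} (J-open P) (λ _ → tt) {V P} {V P} {φ} {ψ}) ,
      normalized-surjective P Q e (proj₂ (intertwining Q∈))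

    Unicity-normalized : Unicity 𝔛 → Unicity (normalized 𝔛)
    Unicity-normalized unicity {P} {P′} (Q , Q∈ , e) (Q′ , Q′∈ , e′) f =
      let g , c = unicity Q∈ Q′∈
            (≅-trans (≅-sym (ind-normalized P Q e)) (≅-trans f (ind-normalized P′ Q′ e′)))
      in g , ≅ₚ-trans {R.conjPair G C g P} {R.conjPair G C g (R.normalizePair G C Q)} {P′}
           (conjPair-cong g {P} {R.normalizePair G C Q} e)
           (≅ₚ-trans {R.conjPair G C g (R.normalizePair G C Q)} {R.normalizePair G C Q′} {P′}
             (conj-normalizePair g {Q} {Q′} c) (≅ₚ-sym {P′} {R.normalizePair G C Q′} e′))

    Exhaustion-normalized : ∀ 𝒵 → Exhaustion 𝒵 𝔛 → Exhaustion 𝒵 (normalized 𝔛)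
    Exhaustion-normalized 𝒵 (ind∈ , exhaust) =
      (λ {P} (Q , Q∈ , e) → RepSet.resp 𝒵 (≅-sym (ind-normalized P Q e)) (ind∈ Q∈)) ,
      λ W∈ → let Q , Q∈ , f = exhaust W∈
                 e = ≅ₚ-refl (R.normalizePair G C Q)
             in R.normalizePair G C Q , (Q , Q∈ , e) ,
                ≅-trans f (≅-sym (ind-normalized (R.normalizePair G C Q) Q e))

    module _ (H : Subgroup (Aut C)) where

      Stable-normalized : Stable H 𝔛 → Stable H (normalized 𝔛)
      Stable-normalized stable {P} {σ} (Q , Q∈ , e) σ∈ =
        R.twistPair G C σ Q , stable Q∈ σ∈ , twist-normalized P Q e σ

      twist-invariant : Unicity 𝔛 → Stable H 𝔛 → ∀ P σ → P ∈ Memₚ (normalized 𝔛) → σ ∈ Mem H →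
        R.ind G C P ≅ R.ind G C (R.twistPair G C σ P) → V P ≅ R.twist G C σ (V P)
      twist-invariant unicity stable P σ (Q , Q∈ , e) σ∈ f =
        -- H-stability puts the twist of `Q` in `𝔛`, so unicity compares it with `Q`.
        let g , c = unicity {Q} {R.twistPair G C σ Q} Q∈ (stable {Q} {σ} Q∈ σ∈) (ind-untwist P Q e σ f)
        in normalized-twist-invariant P Q e σ g c

      StableUnicity-normalized : Unicity 𝔛 → Stable H 𝔛 → StableUnicity H (normalized 𝔛)
      StableUnicity-normalized unicity stable =
        (λ {P} {σ} → Stable-normalized stable {P} {σ}) , λ {P} {σ} → twist-invariant unicity stable P σ

proposition3p18 : (∀ {a} → ExcludedMiddle a) →
    ∀ {ℓ : Level} (G : LocallyProfiniteGroup ℓ) (C : Field ℓ) →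
    let open LocallyProfiniteGroup G using (IsClosed)
        open Subgroups G
        open Representations G C in
    (Z : Sub) → IsClosed (Subgroup.Mem Z) → IsCentral Z →
    (𝔛 : PairSet) → ConsistsOfCTypes 𝔛 →
    (𝒵 : RepSet) → (∀ {W} → W ∈ RepSet.Memᵣ 𝒵 → Irreducible W × ZCompact Z W) →
    (H : Subgroup (Aut C)) →
    ConsistsOfCTypes (normalized 𝔛) ×
    (Intertwining 𝔛 → Intertwining (normalized 𝔛)) ×
    (Unicity 𝔛 → Unicity (normalized 𝔛)) ×
    (Exhaustion 𝒵 𝔛 → Exhaustion 𝒵 (normalized 𝔛)) ×
    (Stable H 𝔛 → Stable H (normalized 𝔛)) ×
    (Unicity 𝔛 → Stable H 𝔛 → StableUnicity H (normalized 𝔛))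
proposition3p18 em G C _ _ _ 𝔛 ctypes 𝒵 _ H =
  (λ {P} → CTypes-normalized 𝔛 (λ {Q} → ctypes {Q}) {P}) ,
  Intertwining-normalized 𝔛 ,
  Unicity-normalized 𝔛 ,
  Exhaustion-normalized 𝔛 𝒵 ,
  Stable-normalized 𝔛 H ,
  StableUnicity-normalized 𝔛 H
  where open Types em G C
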